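{- For every natural number $s\in\mathbb{N}$ there exists $m=m(s)\in\mathbb{N}$ such that for every finite set $A$ of real numbers, \[ |(sA-sA)^{(m)}| \gg_s |A|^{s}. \]
   Context: For $X\subseteq\mathbb{R}$, $sX-sX=\{x_1+\dots+x_s-y_1-\dots-y_s:x_i,y_j\in X\}$, and $X^{(m)}$ denotes the $m$-fold product set $\{x_1x_2\cdots x_m: x_i\in X\}$. The notation $X\gg_s Y$ means $X\ge c(s)Y$ for a constant $c(s)>0$ depending only on $s$. -}

module Defs where

open import Level using (0ℓ)
open import Data.Nat using (ℕ; zero; suc)
open import Data.Fin using (Fin; zero; suc)
open import Data.Sum using (_⊎_)
open import Data.Product using (Σ; ∃; _×_; _,_)
open import Data.List using (List)
open import Data.List.Relation.Unary.Any using (Any)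
open import Data.List.Relation.Unary.AllPairs using (AllPairs)
open import Relation.Nullary using (¬_)
open import Relation.Binary using (Rel; IsStrictTotalOrder)
open import Algebra.Bundles using (CommutativeRing)

-- Axiomatic real numbers: a complete (Dedekind / least-upper-bound)
-- ordered field.  Any model is (classically) isomorphic to ℝ.
record RealNumbers : Set₁ where
  field
    commRing : CommutativeRing 0ℓ 0ℓ
  open CommutativeRing commRing public
  field
    _<_ : Rel Carrier 0ℓ
    isStrictTotalOrder : IsStrictTotalOrder _≈_ _<_
    nontrivial : ¬ (1# ≈ 0#)
    inverse : ∀ x → ¬ (x ≈ 0#) → ∃ λ y → (x * y) ≈ 1#
    +-mono-< : ∀ x y z → x < y → (x + z) < (y + z)
    *-pos : ∀ x y → 0# < x → 0# < y → 0# < (x * y)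
    complete : (P : Carrier → Set) → ∃ P →
               ∃ (λ b → ∀ x → P x → (x < b) ⊎ (x ≈ b)) →
               ∃ λ u → (∀ x → P x → (x < u) ⊎ (x ≈ u)) ×
                       (∀ b → (∀ x → P x → (x < b) ⊎ (x ≈ b)) → (u < b) ⊎ (u ≈ b))

module _ (R : RealNumbers) where
  open RealNumbers R using (Carrier; _≈_; _+_; _*_; _-_; 0#; 1#)

  sumF : ∀ {k} → (Fin k → Carrier) → Carrier
  sumF {zero}  f = 0#
  sumF {suc k} f = f zero + sumF (λ i → f (suc i))

  prodF : ∀ {k} → (Fin k → Carrier) → Carrier
  prodF {zero}  f = 1#
  prodF {suc k} f = f zero * prodF (λ i → f (suc i))

  _∈ᴸ_ : Carrier → List Carrier → Set
  x ∈ᴸ A = Any (x ≈_) A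

  -- a list with pairwise distinct entries (a finite set, |A| = length A)
  Distinct : List Carrier → Set
  Distinct = AllPairs (λ x y → ¬ (x ≈ y))

  InSumDiff : ℕ → List Carrier → Carrier → Set
  InSumDiff s A z = Σ (Fin s → Carrier) λ xs → Σ (Fin s → Carrier) λ ys →
    (∀ i → xs i ∈ᴸ A) × (∀ i → ys i ∈ᴸ A) × (z ≈ (sumF xs - sumF ys))

  InProdSet : ℕ → (Carrier → Set) → Carrier → Set
  InProdSet m X z = Σ (Fin m → Carrier) λ xs → (∀ i → X (xs i)) × (z ≈ prodF xs)

-- Write s = t + 1 and let δ = b′ - b be the smallest gap of A. For a, a₀ ∈ A and 0 ≤ j ≤ 2t the set
-- D = sA - sA contains (a - a₀) + (j - t)δ = δ(y + j), where y = (a - a₀)/δ - t, so D contains 2t + 1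
-- consecutive translates of every point of a dilate Y of A, and we may thin Y until its gaps are large.
--
-- Let G₀(y) = 1/y and G_{k+1}(y) = G_k(y)/G_k(y + 1); up to powers of δ, G₀, …, G_{2t} are ratios of
-- products of elements of D. Since G_k (k ≥ 1) has the expansion 1 + c u^k + O(u^{k+1}) in u = 1/y with
-- c > 0, the ratio of two values of G_k on Y exceeds every product of values of G_{k+1}, G_{k+2}, … at
-- later points. Hence the products G₀(y₀)⋯G_{2t}(y_{2t}) with y₀ ≤ ⋯ ≤ y_{2t} in Y are distinct: this
-- gives ≫ |Y|^{2s-1} ratios p/q with p, q ∈ D^(m). The pairs (px, qx) with x ∈ Y are then distinct as well,
-- so |D^(m+1)|² ≫ |Y|^{2s}.
module Submission where

open import Defs
import Data.Nat as ℕ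
import Data.Nat.Properties as ℕ
import Data.Nat.Solver as ℕSolver
open import Data.Nat using (ℕ; suc; _!)
open import Data.Integer as ℤ using (ℤ; +_; -[1+_])
import Data.Integer.Properties as ℤ
open import Data.Integer.Solver using (module +-*-Solver)
open import Data.Fin as Fin using (Fin)
import Data.Fin.Properties as Fin
open import Data.List using (List; []; _∷_; length; map; _++_; lookup; cartesianProduct; deduplicate)
open import Data.List.Properties using (length-++; length-map)
open import Data.List.Membership.Propositional using (_∈_)
open import Data.List.Membership.Propositional.Properties using (∈-lookup; ∈-map⁺)
open import Data.List.Relation.Unary.All as All using (All; []; _∷_)
import Data.List.Relation.Unary.All.Properties as All
open import Data.List.Relation.Unary.Any as Any using (Any; here; there)
import Data.List.Relation.Unary.Any.Properties as Any
open import Data.List.Relation.Unary.AllPairs as AllPairs using (AllPairs; []; _∷_)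
import Data.List.Relation.Unary.AllPairs.Properties as AllPairs
import Data.List.Relation.Unary.Linked.Properties as Linked
import Data.List.Relation.Unary.Unique.DecSetoid.Properties as Unique
open import Data.List.Relation.Binary.Permutation.Propositional using (_↭_; ↭-sym; ↭⇒↭ₛ)
open import Data.List.Relation.Binary.Permutation.Propositional.Properties using (∈-resp-↭; ↭-length)
import Data.List.Relation.Binary.Permutation.Setoid.Properties as Permutation
import Data.List.Sort as Sort
open import Data.Maybe using (Maybe; just; nothing)
open import Data.Product using (Σ; _×_; _,_; proj₁; proj₂)
open import Data.Sum using (_⊎_; inj₁; inj₂)
open import Data.Empty using (⊥-elim)
open import Relation.Nullary using (¬_; yes; no)
open import Relation.Binary using (IsStrictTotalOrder; StrictTotalOrder; DecTotalOrder; DecSetoid; tri<; tri≈; tri>)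
import Relation.Binary.Properties.StrictTotalOrder as StrictTotalOrderProperties
open import Relation.Binary.PropositionalEquality as ≡ using (_≡_)
import Relation.Binary.Reasoning.Setoid as SetoidReasoning
import Algebra.Properties.Ring as RingProperties
import Algebra.Properties.Semiring.Mult as Multiplication
import Algebra.Properties.Semiring.Exp as Exponentiation
import Algebra.Solver.Ring
open import Algebra.Solver.Ring.AlmostCommutativeRing using (fromCommutativeRing; _-Raw-AlmostCommutative⟶_)

-- Ordered field arithmetic

-- The exponent m and the implied constant are fixed before the model and A are given. Every
-- constant is therefore a natural number computed from integer polynomials: expansions in 1/y
-- become two-sided inequalities with explicit errors, and no limit is taken. The obstacle is a tie
-- of orders. For reciprocals v > u of two points, the main terms of G_k differ by c(v^k - u^k),
-- which for gaps of bounded size is only of order v^(k+1); that is also the order of the error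
-- terms and of G_{k+1} - 1. Only a constant can break the tie: gaps of size 2a make the separation
-- grow with a, and a is taken larger than the error constants of all levels. Tuples are monotone
-- because G_{k+1} at a much earlier point than y may exceed the separation at y; the restriction
-- costs only the factor (2t + 1)!. The number of levels is forced: G_k uses the translates by 0,
-- ..., k, so 2t + 1 translates carry 2t + 1 levels, one short of the exponent 2s that a square root
-- turns into s. The extra x closes this gap.

module OrderedField (R : RealNumbers) where
  open RealNumbers R public hiding (zero) renaming (_*_ to _·_; _<_ to infix 4 _<_)
  open IsStrictTotalOrder isStrictTotalOrder public
    using (_≟_; compare; <-respˡ-≈; <-respʳ-≈)
    renaming (trans to <-trans; irrefl to <-irrefl)
  open RingProperties ring public using (-‿+-comm; -‿distribˡ-*; -‿distribʳ-*; -0#≈0#; -‿involutive)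
  open Multiplication semiring using (×-homo-+; ×1-homo-*) renaming (_×_ to _×′_)
  open Exponentiation semiring public using (_^_; ^-homo-*)
  open SetoidReasoning setoid

  -- Supplies the integer coefficients of the ring solver and carries model-independent constants
  -- into the field. Since `ι (+ 1)` unfolds to `1# + 0#`, many steps below convert by `ι-1`.
  ι : ℤ → Carrier
  ι (+ n)    = n ×′ 1#
  ι -[1+ n ] = - (suc n ×′ 1#)

  private
    cancel-common : ∀ x y z → (x + y) - (x + z) ≈ y - z
    cancel-common x y z = begin
      (x + y) + - (x + z)     ≈⟨ +-congˡ (sym (-‿+-comm x z)) ⟩
      (x + y) + (- x + - z)   ≈⟨ +-congʳ (+-comm x y) ⟩
      (y + x) + (- x + - z)   ≈⟨ +-assoc y x _ ⟩
      y + (x + (- x + - z))   ≈⟨ +-congˡ (sym (+-assoc x (- x) (- z))) ⟩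
      y + ((x + - x) + - z)   ≈⟨ +-congˡ (+-congʳ (-‿inverseʳ x)) ⟩
      y + (0# + - z)          ≈⟨ +-congˡ (+-identityˡ _) ⟩
      y - z                   ∎

    ι-⊖ : ∀ m n → ι (m ℤ.⊖ n) ≈ m ×′ 1# - n ×′ 1#
    ι-⊖ ℕ.zero ℕ.zero       = sym (-‿inverseʳ 0#)
    ι-⊖ ℕ.zero (suc n)      = sym (+-identityˡ _)
    ι-⊖ (suc m) ℕ.zero      = sym (trans (+-congˡ -0#≈0#) (+-identityʳ _))
    ι-⊖ (suc m) (suc n)     = begin
      ι (suc m ℤ.⊖ suc n)             ≡⟨ ≡.cong ι (ℤ.[1+m]⊖[1+n]≡m⊖n m n) ⟩
      ι (m ℤ.⊖ n)                     ≈⟨ ι-⊖ m n ⟩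
      m ×′ 1# - n ×′ 1#               ≈⟨ sym (cancel-common 1# _ _) ⟩
      suc m ×′ 1# - suc n ×′ 1#       ∎

  ι-neg : ∀ a → ι (ℤ.- a) ≈ - ι a
  ι-neg (+ ℕ.zero)  = sym -0#≈0#
  ι-neg (+ suc n)   = refl
  ι-neg -[1+ n ]    = sym (-‿involutive _)

  ι-+ : ∀ a b → ι (a ℤ.+ b) ≈ ι a + ι b
  ι-+ (+ m) (+ n)         = ×-homo-+ 1# m n
  ι-+ (+ m) -[1+ n ]      = ι-⊖ m (suc n)
  ι-+ -[1+ m ] (+ n)      = trans (ι-⊖ n (suc m)) (+-comm _ _)
  ι-+ -[1+ m ] -[1+ n ]   = begin
    - (suc (suc (m ℕ.+ n)) ×′ 1#)        ≡⟨ ≡.cong (λ k → - (k ×′ 1#)) (≡.cong suc (≡.sym (ℕ.+-suc m n))) ⟩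
    - ((suc m ℕ.+ suc n) ×′ 1#)          ≈⟨ -‿cong (×-homo-+ 1# (suc m) (suc n)) ⟩
    - (suc m ×′ 1# + suc n ×′ 1#)        ≈⟨ sym (-‿+-comm _ _) ⟩
    - (suc m ×′ 1#) + - (suc n ×′ 1#)    ∎

  private
    ι-*-pos : ∀ m b → ι (+ m ℤ.* b) ≈ ι (+ m) · ι b
    ι-*-pos m (+ n) = begin
      ι (+ m ℤ.* + n)          ≡⟨ ≡.cong ι (≡.sym (ℤ.pos-* m n)) ⟩
      (m ℕ.* n) ×′ 1#          ≈⟨ ×1-homo-* m n ⟩
      ι (+ m) · ι (+ n)        ∎
    ι-*-pos m -[1+ n ] = begin
      ι (+ m ℤ.* (ℤ.- + suc n))    ≡⟨ ≡.cong ι (≡.sym (ℤ.neg-distribʳ-* (+ m) (+ suc n))) ⟩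
      ι (ℤ.- (+ m ℤ.* + suc n))    ≈⟨ ι-neg (+ m ℤ.* + suc n) ⟩
      - ι (+ m ℤ.* + suc n)        ≈⟨ -‿cong (ι-*-pos m (+ suc n)) ⟩
      - (ι (+ m) · ι (+ suc n))    ≈⟨ -‿distribʳ-* _ _ ⟩
      ι (+ m) · ι -[1+ n ]         ∎

  ι-* : ∀ a b → ι (a ℤ.* b) ≈ ι a · ι b
  ι-* (+ m) b = ι-*-pos m b
  ι-* -[1+ m ] b = begin
    ι ((ℤ.- + suc m) ℤ.* b)      ≡⟨ ≡.cong ι (≡.sym (ℤ.neg-distribˡ-* (+ suc m) b)) ⟩
    ι (ℤ.- (+ suc m ℤ.* b))      ≈⟨ ι-neg (+ suc m ℤ.* b) ⟩
    - ι (+ suc m ℤ.* b)          ≈⟨ -‿cong (ι-*-pos (suc m) b) ⟩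
    - (ι (+ suc m) · ι b)        ≈⟨ -‿distribˡ-* _ _ ⟩
    ι -[1+ m ] · ι b             ∎

  ι-1 : ι (+ 1) ≈ 1#
  ι-1 = +-identityʳ 1#

  private
    ι-homomorphism : ℤ.+-*-rawRing -Raw-AlmostCommutative⟶ fromCommutativeRing commRing
    ι-homomorphism = record
      { ⟦_⟧ = ι ; +-homo = ι-+ ; *-homo = ι-* ; -‿homo = ι-neg ; 0-homo = refl ; 1-homo = ι-1 }

    ι-≟ : ∀ a b → Maybe (ι a ≈ ι b)
    ι-≟ a b with a ℤ.≟ b
    ... | yes ≡.refl = just refl
    ... | no _       = nothing

  open Algebra.Solver.Ring ℤ.+-*-rawRing (fromCommutativeRing commRing) ι-homomorphism ι-≟ public
    using (solve; _:=_; _:+_; _:*_; _:-_; :-_; con)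

  -- Orders are reduced to signs of differences, so that an inequality is proved by exhibiting
  -- the difference as a combination of quantities of known sign, checked by the ring solver.
  Pos Nonneg : Carrier → Set
  Pos x    = 0# < x
  Nonneg x = Pos x ⊎ x ≈ 0#

  infix 4 _≼_
  record _≼_ (x y : Carrier) : Set where
    constructor ≼-intro
    field ≼-diff : Nonneg (y - x)
  open _≼_ public

  Pos-resp : ∀ {x y} → x ≈ y → Pos x → Pos y
  Pos-resp = <-respʳ-≈

  Nonneg-resp : ∀ {x y} → x ≈ y → Nonneg x → Nonneg y
  Nonneg-resp e (inj₁ p) = inj₁ (Pos-resp e p)
  Nonneg-resp e (inj₂ z) = inj₂ (trans (sym e) z)

  Pos-+ : ∀ {x y} → Pos x → Nonneg y → Pos (x + y)
  Pos-+ {x} {y} p (inj₁ q) = <-trans q (<-respˡ-≈ (+-identityˡ y) (+-mono-< 0# x y p))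
  Pos-+ {x} {y} p (inj₂ z) = Pos-resp (sym (trans (+-congˡ z) (+-identityʳ x))) p

  Nonneg-+ : ∀ {x y} → Nonneg x → Nonneg y → Nonneg (x + y)
  Nonneg-+ (inj₁ p) q         = inj₁ (Pos-+ p q)
  Nonneg-+ {x} {y} (inj₂ z) q = Nonneg-resp (sym (trans (+-congʳ z) (+-identityˡ y))) q

  Pos-· : ∀ {x y} → Pos x → Pos y → Pos (x · y)
  Pos-· = *-pos _ _

  Nonneg-· : ∀ {x y} → Nonneg x → Nonneg y → Nonneg (x · y)
  Nonneg-· (inj₁ p) (inj₁ q) = inj₁ (Pos-· p q)
  Nonneg-· (inj₁ p) (inj₂ z) = inj₂ (trans (*-congˡ z) (zeroʳ _))
  Nonneg-· (inj₂ z) q        = inj₂ (trans (*-congʳ z) (zeroˡ _))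

  Pos-diff⇒< : ∀ {x y} → Pos (y - x) → x < y
  Pos-diff⇒< {x} {y} p = <-respˡ-≈ (+-identityˡ x)
    (<-respʳ-≈ (solve 2 (λ x y → (y :- x) :+ x := y) refl x y) (+-mono-< 0# (y - x) x p))

  <⇒Pos-diff : ∀ {x y} → x < y → Pos (y - x)
  <⇒Pos-diff {x} {y} l = <-respˡ-≈ (-‿inverseʳ x) (+-mono-< x y (- x) l)

  ≼-by : ∀ {x y z} → Nonneg z → z ≈ y - x → x ≼ y
  ≼-by p e = ≼-intro (Nonneg-resp e p)

  <-by : ∀ {x y z} → Pos z → z ≈ y - x → x < y
  <-by p e = Pos-diff⇒< (Pos-resp e p)

  <⇒≼ : ∀ {x y} → x < y → x ≼ y
  <⇒≼ l = ≼-intro (inj₁ (<⇒Pos-diff l))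

  ≈⇒≼ : ∀ {x y} → x ≈ y → x ≼ y
  ≈⇒≼ {x} {y} e = ≼-intro (inj₂ (trans (+-congʳ (sym e)) (-‿inverseʳ x)))

  ≼-refl : ∀ {x} → x ≼ x
  ≼-refl = ≈⇒≼ refl

  ≼-trans : ∀ {x y z} → x ≼ y → y ≼ z → x ≼ z
  ≼-trans {x} {y} {z} p q = ≼-by (Nonneg-+ (≼-diff p) (≼-diff q))
    (solve 3 (λ x y z → (y :- x) :+ (z :- y) := z :- x) refl x y z)

  <-≼-trans : ∀ {x y z} → x < y → y ≼ z → x < z
  <-≼-trans {x} {y} {z} p q = <-by (Pos-+ (<⇒Pos-diff p) (≼-diff q))
    (solve 3 (λ x y z → (y :- x) :+ (z :- y) := z :- x) refl x y z)

  ≼-<-trans : ∀ {x y z} → x ≼ y → y < z → x < z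
  ≼-<-trans {x} {y} {z} p q = <-by (Pos-+ (<⇒Pos-diff q) (≼-diff p))
    (solve 3 (λ x y z → (z :- y) :+ (y :- x) := z :- x) refl x y z)

  ≼-resp : ∀ {x x′ y y′} → x ≈ x′ → y ≈ y′ → x ≼ y → x′ ≼ y′
  ≼-resp e f p = ≼-trans (≈⇒≼ (sym e)) (≼-trans p (≈⇒≼ f))

  Nonneg⇒0≼ : ∀ {x} → Nonneg x → 0# ≼ x
  Nonneg⇒0≼ {x} p = ≼-by p (solve 1 (λ x → x := x :- con (+ 0)) refl x)

  0≼⇒Nonneg : ∀ {x} → 0# ≼ x → Nonneg x
  0≼⇒Nonneg {x} p = Nonneg-resp (solve 1 (λ x → x :- con (+ 0) := x) refl x) (≼-diff p)

  +-mono-≼ : ∀ {x x′ y y′} → x ≼ x′ → y ≼ y′ → x + y ≼ x′ + y′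
  +-mono-≼ {x} {x′} {y} {y′} p q = ≼-by (Nonneg-+ (≼-diff p) (≼-diff q))
    (solve 4 (λ x x′ y y′ → (x′ :- x) :+ (y′ :- y) := (x′ :+ y′) :- (x :+ y)) refl x x′ y y′)

  ·-monoˡ-≼ : ∀ {x y z} → Nonneg z → x ≼ y → z · x ≼ z · y
  ·-monoˡ-≼ {x} {y} {z} n p = ≼-by (Nonneg-· n (≼-diff p))
    (solve 3 (λ x y z → z :* (y :- x) := z :* y :- z :* x) refl x y z)

  ·-mono-≼ : ∀ {x x′ y y′} → Nonneg x → Nonneg y′ → x ≼ x′ → y ≼ y′ → x · y ≼ x′ · y′
  ·-mono-≼ {x} {x′} {y} {y′} m n p q = ≼-by
    (Nonneg-+ (Nonneg-· m (≼-diff q)) (Nonneg-· (≼-diff p) n))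
    (solve 4 (λ x x′ y y′ → x :* (y′ :- y) :+ (x′ :- x) :* y′ := x′ :* y′ :- x :* y) refl x x′ y y′)

  ·-monoˡ-< : ∀ {x y z} → Pos z → x < y → z · x < z · y
  ·-monoˡ-< {x} {y} {z} n p = <-by (Pos-· n (<⇒Pos-diff p))
    (solve 3 (λ x y z → z :* (y :- x) := z :* y :- z :* x) refl x y z)

  Pos⇒≉0 : ∀ {x} → Pos x → ¬ (x ≈ 0#)
  Pos⇒≉0 p e = <-irrefl refl (Pos-resp e p)

  <⇒≉ : ∀ {x y} → x < y → ¬ (x ≈ y)
  <⇒≉ l e = <-irrefl e l

  Pos-≼ : ∀ {x y} → Pos x → x ≼ y → Pos y
  Pos-≼ = <-≼-trans

  ≼⊎> : ∀ x y → x ≼ y ⊎ y < x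
  ≼⊎> x y with compare x y
  ... | tri< l _ _ = inj₁ (<⇒≼ l)
  ... | tri≈ _ e _ = inj₁ (≈⇒≼ e)
  ... | tri> _ _ g = inj₂ g

  private
    Neg-negate : ∀ {x} → x < 0# → Pos (- x)
    Neg-negate {x} l = Pos-resp (+-identityˡ _) (<⇒Pos-diff l)

  ·-cancel-Nonneg : ∀ {x y} → Pos y → Nonneg (x · y) → Nonneg x
  ·-cancel-Nonneg {x} {y} p n with compare 0# x
  ... | tri< l _ _ = inj₁ l
  ... | tri≈ _ e _ = inj₂ (sym e)
  ... | tri> _ _ g = ⊥-elim (<-irrefl refl (Pos-resp
          (solve 2 (λ x y → (:- x) :* y :+ x :* y := con (+ 0)) refl x y)
          (Pos-+ (Pos-· (Neg-negate g) p) n)))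

  ·-cancel-Pos : ∀ {x y} → Pos y → Pos (x · y) → Pos x
  ·-cancel-Pos {x} {y} p n with ·-cancel-Nonneg {x} p (inj₁ n)
  ... | inj₁ q = q
  ... | inj₂ e = ⊥-elim (<-irrefl (sym (trans (*-congʳ e) (zeroˡ y))) n)

  0<1 : Pos 1#
  0<1 with compare 0# 1#
  ... | tri< l _ _ = l
  ... | tri≈ _ e _ = ⊥-elim (nontrivial (sym e))
  ... | tri> _ _ g = Pos-resp
          (trans (solve 1 (λ x → (:- x) :* (:- x) := x :* x) refl 1#) (*-identityˡ 1#))
          (Pos-· (Neg-negate g) (Neg-negate g))

  ι-Nonneg : ∀ n → Nonneg (ι (+ n))
  ι-Nonneg ℕ.zero  = inj₂ refl
  ι-Nonneg (suc n) = inj₁ (Pos-+ 0<1 (ι-Nonneg n))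

  ι-Pos : ∀ n → Pos (ι (+ suc n))
  ι-Pos n = Pos-+ 0<1 (ι-Nonneg n)

  ι-mono : ∀ {a b} → a ℤ.≤ b → ι a ≼ ι b
  ι-mono {a} {b} p = ≼-by (Nonneg-ι (ℤ.i≤j⇒0≤j-i p)) (trans (ι-+ b (ℤ.- a)) (+-congˡ (ι-neg a)))
    where
    Nonneg-ι : ∀ {c} → + 0 ℤ.≤ c → Nonneg (ι c)
    Nonneg-ι (ℤ.+≤+ {n = n} _) = ι-Nonneg n

  ιℕ-mono : ∀ {m n} → m ℕ.≤ n → ι (+ m) ≼ ι (+ n)
  ιℕ-mono p = ι-mono (ℤ.+≤+ p)

  ^-Pos : ∀ {x} n → Pos x → Pos (x ^ n)
  ^-Pos ℕ.zero  p = 0<1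
  ^-Pos (suc n) p = Pos-· p (^-Pos n p)

  ^-mono : ∀ {x y} n → Nonneg x → x ≼ y → x ^ n ≼ y ^ n
  ^-mono ℕ.zero  p l = ≼-refl
  ^-mono {x} {y} (suc n) p l = ·-mono-≼ p (pw n) l (^-mono n p l)
    where
    nn : Nonneg y
    nn = 0≼⇒Nonneg (≼-trans (Nonneg⇒0≼ p) l)
    pw : ∀ n → Nonneg (y ^ n)
    pw ℕ.zero  = inj₁ 0<1
    pw (suc n) = Nonneg-· nn (pw n)

  1^ : ∀ n → 1# ^ n ≈ 1#
  1^ ℕ.zero  = refl
  1^ (suc n) = trans (*-identityˡ _) (1^ n)

  ^≼1 : ∀ {x} n → Pos x → x ≼ 1# → x ^ n ≼ 1#
  ^≼1 n p l = ≼-trans (^-mono n (inj₁ p) l) (≈⇒≼ (1^ n))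

  infix 9 _⁻¹
  -- Total inverse, with the junk value 0⁻¹ = 0.
  _⁻¹ : Carrier → Carrier
  x ⁻¹ with x ≟ 0#
  ... | yes _ = 0#
  ... | no ¬p = proj₁ (inverse x ¬p)

  ⁻¹-inverse : ∀ {x} → ¬ (x ≈ 0#) → x · x ⁻¹ ≈ 1#
  ⁻¹-inverse {x} ¬p with x ≟ 0#
  ... | yes p = ⊥-elim (¬p p)
  ... | no q  = proj₂ (inverse x q)

  ⁻¹-inverse-Pos : ∀ {x} → Pos x → x · x ⁻¹ ≈ 1#
  ⁻¹-inverse-Pos p = ⁻¹-inverse (Pos⇒≉0 p)

  ⁻¹-Pos : ∀ {x} → Pos x → Pos (x ⁻¹)
  ⁻¹-Pos {x} p = ·-cancel-Pos p (Pos-resp (sym (trans (*-comm _ x) (⁻¹-inverse-Pos p))) 0<1)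

  ·-cancelʳ : ∀ {x y z} → ¬ (z ≈ 0#) → x · z ≈ y · z → x ≈ y
  ·-cancelʳ {x} {y} {z} ¬p e = begin
    x                 ≈⟨ sym (*-identityʳ x) ⟩
    x · 1#            ≈⟨ *-congˡ (sym (⁻¹-inverse ¬p)) ⟩
    x · (z · z ⁻¹)    ≈⟨ sym (*-assoc x z _) ⟩
    x · z · z ⁻¹      ≈⟨ *-congʳ e ⟩
    y · z · z ⁻¹      ≈⟨ *-assoc y z _ ⟩
    y · (z · z ⁻¹)    ≈⟨ *-congˡ (⁻¹-inverse ¬p) ⟩
    y · 1#            ≈⟨ *-identityʳ y ⟩
    y                 ∎

-- Integer polynomials and their differences

infixr 5 _+X·_

-- The leading coefficient may be zero, so Poly d contains all polynomials of degree at most d.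
data Poly : ℕ → Set where
  const : ℤ → Poly 0
  _+X·_ : ∀ {d} → ℤ → Poly d → Poly (suc d)

lead : ∀ {d} → Poly d → ℤ
lead (const a)  = a
lead (b +X· p)  = lead p

lowerNorm : ∀ {d} → Poly d → ℕ
lowerNorm (const a) = 0
lowerNorm (b +X· p) = ℤ.∣ b ∣ ℕ.+ lowerNorm p

infixl 6 _⊞_
infixl 7 _⊠_

_⊞_ : ∀ {d} → Poly d → Poly d → Poly d
const a   ⊞ const b   = const (a ℤ.+ b)
(a +X· p) ⊞ (b +X· q) = (a ℤ.+ b) +X· (p ⊞ q)

scale : ∀ {d} → ℤ → Poly d → Poly d
scale c (const a) = const (c ℤ.* a)
scale c (a +X· p) = (c ℤ.* a) +X· scale c p

raise : ∀ {d} → Poly d → Poly (suc d)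
raise (const a) = a +X· const (+ 0)
raise (a +X· p) = a +X· raise p

raiseBy : ∀ n {d} → Poly d → Poly (n ℕ.+ d)
raiseBy ℕ.zero  p = p
raiseBy (suc n) p = raise (raiseBy n p)

-- The summand `a · q` is padded with zero top coefficients: its type then agrees definitionally
-- with that of the other summand, and it cannot disturb the leading coefficient.
_⊠_ : ∀ {d e} → Poly d → Poly e → Poly (d ℕ.+ e)
const a         ⊠ q = scale a q
_+X·_ {d} a p   ⊠ q = ((+ 0) +X· (p ⊠ q)) ⊞ raiseBy (suc d) (scale a q)

-- From Δ(b + X·p) = (X + 1)·Δp + p.
Δ : ∀ {d} → Poly (suc d) → Poly d
Δ (b +X· const a)       = const a
Δ (b +X· p@(_ +X· _))   = ((+ 0) +X· Δ p) ⊞ raise (Δ p) ⊞ p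

lead-⊞ : ∀ {d} (p q : Poly d) → lead (p ⊞ q) ≡ lead p ℤ.+ lead q
lead-⊞ (const a) (const b) = ≡.refl
lead-⊞ (a +X· p) (b +X· q) = lead-⊞ p q

lead-scale : ∀ {d} c (p : Poly d) → lead (scale c p) ≡ c ℤ.* lead p
lead-scale c (const a) = ≡.refl
lead-scale c (a +X· p) = lead-scale c p

lead-raise : ∀ {d} (p : Poly d) → lead (raise p) ≡ + 0
lead-raise (const a) = ≡.refl
lead-raise (a +X· p) = lead-raise p

lead-⊠ : ∀ {d e} (p : Poly d) (q : Poly e) → lead (p ⊠ q) ≡ lead p ℤ.* lead q
lead-⊠ (const a) q = lead-scale a q
lead-⊠ (_+X·_ {d} a p) q = begin
  lead (((+ 0) +X· (p ⊠ q)) ⊞ raise (raiseBy d (scale a q)))  ≡⟨ lead-⊞ ((+ 0) +X· (p ⊠ q)) (raise (raiseBy d (scale a q))) ⟩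
  lead (p ⊠ q) ℤ.+ lead (raise (raiseBy d (scale a q)))        ≡⟨ ≡.cong₂ ℤ._+_ (lead-⊠ p q) (lead-raise (raiseBy d (scale a q))) ⟩
  lead p ℤ.* lead q ℤ.+ + 0                                    ≡⟨ ℤ.+-identityʳ _ ⟩
  lead p ℤ.* lead q                                            ∎
  where open ≡.≡-Reasoning

lead-Δ : ∀ {d} (p : Poly (suc d)) → lead (Δ p) ≡ + suc d ℤ.* lead p
lead-Δ (b +X· const a) = ≡.sym (ℤ.*-identityˡ a)
lead-Δ {suc d} (b +X· p@(_ +X· _)) = begin
  lead (((+ 0) +X· Δ p) ⊞ raise (Δ p) ⊞ p)                ≡⟨ lead-⊞ (((+ 0) +X· Δ p) ⊞ raise (Δ p)) p ⟩
  lead (((+ 0) +X· Δ p) ⊞ raise (Δ p)) ℤ.+ lead p         ≡⟨ ≡.cong (ℤ._+ lead p) (lead-⊞ ((+ 0) +X· Δ p) (raise (Δ p))) ⟩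
  lead (Δ p) ℤ.+ lead (raise (Δ p)) ℤ.+ lead p            ≡⟨ ≡.cong (λ t → lead (Δ p) ℤ.+ t ℤ.+ lead p) (lead-raise (Δ p)) ⟩
  lead (Δ p) ℤ.+ + 0 ℤ.+ lead p                           ≡⟨ ≡.cong (λ t → t ℤ.+ + 0 ℤ.+ lead p) (lead-Δ p) ⟩
  + suc d ℤ.* lead p ℤ.+ + 0 ℤ.+ lead p                   ≡⟨ solve 2 (λ n l → n :* l :+ con (+ 0) :+ l := (con (+ 1) :+ n) :* l) ≡.refl (+ suc d) (lead p) ⟩
  + suc (suc d) ℤ.* lead p                                ∎
  where
  open ≡.≡-Reasoning
  open +-*-Solver

linear : ℕ → Poly 1
linear j = + j +X· const (+ 1)

shiftPoly : (js : List ℕ) → Poly (length js)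
shiftPoly []       = const (+ 1)
shiftPoly (j ∷ js) = linear j ⊠ shiftPoly js

shiftPoly-monic : ∀ js → lead (shiftPoly js) ≡ + 1
shiftPoly-monic []       = ≡.refl
shiftPoly-monic (j ∷ js) = ≡.trans (lead-⊠ (linear j) (shiftPoly js))
  (≡.trans (ℤ.*-identityˡ _) (shiftPoly-monic js))

-- The shifts i of the factors y + i above and below the bar in G_k. Division by G_k(y + 1) swaps
-- the two roles of the shifted lists. From level 1 on both lists have 2^(k-1) entries.
nums dens : ℕ → List ℕ
nums ℕ.zero  = []
nums (suc k) = nums k ++ map suc (dens k)
dens ℕ.zero  = 0 ∷ []
dens (suc k) = dens k ++ map suc (nums k)

length-nums≡dens : ∀ k → length (nums (suc k)) ≡ length (dens (suc k))
length-nums≡dens ℕ.zero  = ≡.refl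
length-nums≡dens (suc k) = begin
  length (nums (suc k) ++ map suc (dens (suc k)))         ≡⟨ length-++ (nums (suc k)) ⟩
  length (nums (suc k)) ℕ.+ length (map suc (dens (suc k))) ≡⟨ ≡.cong₂ ℕ._+_ (length-nums≡dens k) (length-map suc (dens (suc k))) ⟩
  length (dens (suc k)) ℕ.+ length (dens (suc k))         ≡⟨ ≡.cong (length (dens (suc k)) ℕ.+_) (≡.sym (≡.trans (length-map suc (nums (suc k))) (length-nums≡dens k))) ⟩
  length (dens (suc k)) ℕ.+ length (map suc (nums (suc k))) ≡⟨ ≡.sym (length-++ (dens (suc k))) ⟩
  length (dens (suc k) ++ map suc (nums (suc k)))         ∎
  where open ≡.≡-Reasoning

module Evaluation (R : RealNumbers) where
  open OrderedField R
  open SetoidReasoning setoid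

  eval : ∀ {d} → Poly d → Carrier → Carrier
  eval (const a) x = ι a
  eval (b +X· p) x = ι b + x · eval p x

  shiftProd : List ℕ → Carrier → Carrier
  shiftProd []       x = 1#
  shiftProd (j ∷ js) x = (x + ι (+ j)) · shiftProd js x

  eval-⊞ : ∀ {d} (p q : Poly d) x → eval (p ⊞ q) x ≈ eval p x + eval q x
  eval-⊞ (const a) (const b) x = ι-+ a b
  eval-⊞ (a +X· p) (b +X· q) x = trans (+-cong (ι-+ a b) (*-congˡ (eval-⊞ p q x)))
    (solve 5 (λ a b x p q → (a :+ b) :+ x :* (p :+ q) := (a :+ x :* p) :+ (b :+ x :* q)) refl
      (ι a) (ι b) x (eval p x) (eval q x))

  eval-scale : ∀ {d} c (p : Poly d) x → eval (scale c p) x ≈ ι c · eval p x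
  eval-scale c (const a) x = ι-* c a
  eval-scale c (a +X· p) x = trans (+-cong (ι-* c a) (*-congˡ (eval-scale c p x)))
    (solve 4 (λ c a x p → c :* a :+ x :* (c :* p) := c :* (a :+ x :* p)) refl
      (ι c) (ι a) x (eval p x))

  eval-raise : ∀ {d} (p : Poly d) x → eval (raise p) x ≈ eval p x
  eval-raise (const a) x = trans (+-congˡ (zeroʳ x)) (+-identityʳ _)
  eval-raise (a +X· p) x = +-congˡ (*-congˡ (eval-raise p x))

  eval-raiseBy : ∀ n {d} (p : Poly d) x → eval (raiseBy n p) x ≈ eval p x
  eval-raiseBy ℕ.zero  p x = refl
  eval-raiseBy (suc n) p x = trans (eval-raise (raiseBy n p) x) (eval-raiseBy n p x)

  eval-⊠ : ∀ {d e} (p : Poly d) (q : Poly e) x → eval (p ⊠ q) x ≈ eval p x · eval q x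
  eval-⊠ (const a) q x = eval-scale a q x
  eval-⊠ (_+X·_ {d} a p) q x = begin
    eval (((+ 0) +X· (p ⊠ q)) ⊞ raiseBy (suc d) (scale a q)) x   ≈⟨ eval-⊞ ((+ 0) +X· (p ⊠ q)) (raiseBy (suc d) (scale a q)) x ⟩
    0# + x · eval (p ⊠ q) x + eval (raiseBy (suc d) (scale a q)) x  ≈⟨ +-cong (+-congˡ (*-congˡ (eval-⊠ p q x)))
                                                                   (trans (eval-raiseBy (suc d) (scale a q) x) (eval-scale a q x)) ⟩
    0# + x · (eval p x · eval q x) + ι a · eval q x               ≈⟨ solve 4 (λ x p q a → con (+ 0) :+ x :* (p :* q) :+ a :* q := (a :+ x :* p) :* q)
                                                                   refl x (eval p x) (eval q x) (ι a) ⟩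
    (ι a + x · eval p x) · eval q x                               ∎

  eval-Δ : ∀ {d} (p : Poly (suc d)) x → eval p (x + 1#) ≈ eval p x + eval (Δ p) x
  eval-Δ (b +X· const a) x = trans (+-congˡ (*-congʳ (+-congˡ (sym ι-1))))
    (solve 3 (λ b x a → b :+ (x :+ con (+ 1)) :* a := b :+ x :* a :+ a) refl (ι b) x (ι a))
  eval-Δ (b +X· p@(_ +X· _)) x = begin
    ι b + (x + 1#) · eval p (x + 1#)                 ≈⟨ +-congˡ (*-cong (+-congˡ (sym ι-1)) (eval-Δ p x)) ⟩
    ι b + (x + ι (+ 1)) · (P + D)                    ≈⟨ solve 4 (λ b x p d → b :+ (x :+ con (+ 1)) :* (p :+ d)
                                                         := b :+ x :* p :+ (con (+ 0) :+ x :* d :+ d :+ p)) refl (ι b) x P D ⟩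
    ι b + x · P + (0# + x · D + D + P)               ≈⟨ +-congˡ (+-congʳ (+-congˡ (sym (eval-raise (Δ p) x)))) ⟩
    ι b + x · P + (0# + x · D + eval (raise (Δ p)) x + P)
                                                     ≈⟨ +-congˡ (sym (trans (eval-⊞ (((+ 0) +X· Δ p) ⊞ raise (Δ p)) p x)
                                                          (+-congʳ (eval-⊞ ((+ 0) +X· Δ p) (raise (Δ p)) x)))) ⟩
    ι b + x · P + eval (Δ (b +X· p)) x               ∎
    where
    P D : Carrier
    P = eval p x
    D = eval (Δ p) x

  eval-shiftPoly : ∀ js x → eval (shiftPoly js) x ≈ shiftProd js x
  eval-shiftPoly []       x = ι-1
  eval-shiftPoly (j ∷ js) x = trans (eval-⊠ (linear j) (shiftPoly js) x)
    (*-cong (trans (+-congˡ (trans (*-congˡ ι-1) (*-identityʳ x))) (+-comm _ x)) (eval-shiftPoly js x))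

  shiftProd-++ : ∀ is js x → shiftProd (is ++ js) x ≈ shiftProd is x · shiftProd js x
  shiftProd-++ []       js x = sym (*-identityˡ _)
  shiftProd-++ (i ∷ is) js x = trans (*-congˡ (shiftProd-++ is js x)) (sym (*-assoc _ _ _))

  shiftProd-suc : ∀ js x → shiftProd (map suc js) x ≈ shiftProd js (x + 1#)
  shiftProd-suc []       x = refl
  shiftProd-suc (j ∷ js) x = *-cong (sym (+-assoc x 1# _)) (shiftProd-suc js x)

  shiftProd-Pos : ∀ js {x} → Pos x → Pos (shiftProd js x)
  shiftProd-Pos []       p = 0<1
  shiftProd-Pos (j ∷ js) p = Pos-· (Pos-+ p (ι-Nonneg j)) (shiftProd-Pos js p)

  ∣∣-bounds : ∀ b → - ι (+ ℤ.∣ b ∣) ≼ ι b × ι b ≼ ι (+ ℤ.∣ b ∣)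
  ∣∣-bounds (+ n) = ≼-by (Nonneg-+ (ι-Nonneg n) (ι-Nonneg n))
    (solve 1 (λ a → a :+ a := a :- (:- a)) refl (ι (+ n))) , ≼-refl
  ∣∣-bounds -[1+ n ] = ≼-refl , ≼-by (Nonneg-+ (ι-Nonneg (suc n)) (ι-Nonneg (suc n)))
    (solve 1 (λ a → a :+ a := a :- (:- a)) refl (ι (+ suc n)))

  -- With u = 1/x, the factor u^d turns the coefficient of x^i into one of u^(d-i). Every
  -- coefficient below the top keeps at least one factor u, and further factors only shrink it, so
  -- the sum of their absolute values bounds the error.
  eval-asymptotics : ∀ {d} (p : Poly d) {x u} → x · u ≈ 1# → Pos u → u ≼ 1# →
    ι (lead p) - ι (+ lowerNorm p) · u ≼ eval p x · u ^ d ×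
    eval p x · u ^ d ≼ ι (lead p) + ι (+ lowerNorm p) · u
  eval-asymptotics (const a) {x} {u} xu u>0 u≤1 =
    ≈⇒≼ (trans (solve 2 (λ a u → a :- con (+ 0) :* u := a) refl (ι a) u) (sym (*-identityʳ _))) ,
    ≈⇒≼ (trans (*-identityʳ _) (solve 2 (λ a u → a := a :+ con (+ 0) :* u) refl (ι a) u))
  eval-asymptotics {suc d} (b +X· p) {x} {u} xu u>0 u≤1 with eval-asymptotics p xu u>0 u≤1
  ... | lo , hi =
    ≼-by (Nonneg-+ (≼-diff lo) (Nonneg-+ (Nonneg-· (Nonneg-· (≼-diff (proj₁ (∣∣-bounds b))) uu) w≥0)
                                          (Nonneg-· (Nonneg-· (ι-Nonneg ℤ.∣ b ∣) uu) (≼-diff w≤1))))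
      (trans (solve 7 (λ l k u P w b B →
           (P :* w :- (l :- k :* u)) :+ ((b :- (:- B)) :* u :* w :+ B :* u :* (con (+ 1) :- w))
           := (b :* u :* w :+ P :* w) :- (l :- (B :+ k) :* u)) refl (ι (lead p)) K u P w (ι b) B)
        (+-cong (sym value) (-‿cong (+-congˡ (-‿cong (*-congʳ (sym norm))))))) ,
    ≼-by (Nonneg-+ (≼-diff hi) (Nonneg-+ (Nonneg-· (Nonneg-· (≼-diff (proj₂ (∣∣-bounds b))) uu) w≥0)
                                          (Nonneg-· (Nonneg-· (ι-Nonneg ℤ.∣ b ∣) uu) (≼-diff w≤1))))
      (trans (solve 7 (λ l k u P w b B →
           (l :+ k :* u :- P :* w) :+ ((B :- b) :* u :* w :+ B :* u :* (con (+ 1) :- w))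
           := (l :+ (B :+ k) :* u) :- (b :* u :* w :+ P :* w)) refl (ι (lead p)) K u P w (ι b) B)
        (+-cong (+-congˡ (*-congʳ (sym norm))) (-‿cong (sym value))))
    where
    P w K B : Carrier
    P = eval p x
    w = u ^ d
    K = ι (+ lowerNorm p)
    B = ι (+ ℤ.∣ b ∣)
    uu : Nonneg u
    uu = inj₁ u>0
    w≥0 : Nonneg w
    w≥0 = inj₁ (^-Pos d u>0)
    w≤1 : w ≼ ι (+ 1)
    w≤1 = ≼-trans (^≼1 d u>0 u≤1) (≈⇒≼ (sym ι-1))
    norm : ι (+ (ℤ.∣ b ∣ ℕ.+ lowerNorm p)) ≈ B + K
    norm = ι-+ (+ ℤ.∣ b ∣) (+ lowerNorm p)
    value : (ι b + x · P) · (u · w) ≈ ι b · u · w + P · w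
    value = begin
      (ι b + x · P) · (u · w)             ≈⟨ solve 5 (λ b x P u w → (b :+ x :* P) :* (u :* w) := b :* u :* w :+ (x :* u) :* (P :* w)) refl (ι b) x P u w ⟩
      ι b · u · w + (x · u) · (P · w)     ≈⟨ +-congˡ (trans (*-congʳ xu) (*-identityˡ _)) ⟩
      ι b · u · w + P · w                 ∎

  IsNumerator : ∀ {d} → ℕ → Poly d → Set
  IsNumerator k p = ∀ x → shiftProd (nums k) x ≈ shiftProd (dens k) x + eval p x

  IsShiftProd : ∀ {d} → Poly d → List ℕ → Set
  IsShiftProd p js = ∀ x → eval p x ≈ shiftProd js x

-- The polynomial ∏ (X + i) - ∏ (X + j), with i over nums k and j over dens k, has degree exactly
-- |dens k| - k: every multiplicative difference of the ratio gains one order of cancellation.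
record Numerator (k : ℕ) : Set₁ where
  field
    degree   : ℕ
    poly     : Poly degree
    leading  : ℕ
    lead≡    : lead poly ≡ + suc leading
    codegree : length (dens k) ≡ degree ℕ.+ k
    eval≈    : ∀ R → Evaluation.IsNumerator R k poly

module _ (R : RealNumbers) where
  open OrderedField R
  open Evaluation R
  open SetoidReasoning setoid

  eval-subst : ∀ {d e} (eq : d ≡ e) (p : Poly d) x → eval (≡.subst Poly eq p) x ≈ eval p x
  eval-subst ≡.refl p x = refl

  -- The new difference of numerator and denominator is P·D′ - D·P′, whose two products share their
  -- top term. Rewriting it as P·(D′ - D) - D·(P′ - P) performs that cancellation, since each
  -- bracket is a finite difference of lower degree.
  difference-step : ∀ k {d} (p : Poly d) →
    IsNumerator k p → ∀ x →
    shiftProd (nums (suc k)) x ≈ shiftProd (dens (suc k)) x +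
      (eval p x · (shiftProd (dens k) (x + 1#) - shiftProd (dens k) x)
       - shiftProd (dens k) x · (eval p (x + 1#) - eval p x))
  difference-step k p e x = begin
    shiftProd (nums k ++ map suc (dens k)) x    ≈⟨ trans (shiftProd-++ (nums k) _ x) (*-cong (e x) (shiftProd-suc (dens k) x)) ⟩
    (D + P) · D′                                ≈⟨ solve 4 (λ D P D′ P′ → (D :+ P) :* D′ :=
                                                     D :* (D′ :+ P′) :+ (P :* (D′ :- D) :- D :* (P′ :- P))) refl D P D′ P′ ⟩
    D · (D′ + P′) + (P · (D′ - D) - D · (P′ - P))
      ≈⟨ +-congʳ (sym (trans (shiftProd-++ (dens k) _ x) (*-congˡ (trans (shiftProd-suc (nums k) x) (e (x + 1#)))))) ⟩
    shiftProd (dens (suc k)) x + (P · (D′ - D) - D · (P′ - P)) ∎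
    where
    D D′ P P′ : Carrier
    D  = shiftProd (dens k) x
    D′ = shiftProd (dens k) (x + 1#)
    P  = eval p x
    P′ = eval p (x + 1#)

lead-subst : ∀ {d e} (eq : d ≡ e) (p : Poly d) → lead (≡.subst Poly eq p) ≡ lead p
lead-subst ≡.refl p = ≡.refl

-- With D monic of degree d + K and P of degree d, the top coefficients of P·ΔD and D·ΔP are (d +
-- K)·lead P and d·lead P. Their difference K·lead P is positive, so the degree drops no further
-- than intended; by induction the leading coefficient at level K is (K - 1)!.
numerator : ∀ k → Numerator (suc k)
numerator ℕ.zero = record
  { degree = 0 ; poly = const (+ 1) ; leading = 0 ; lead≡ = ≡.refl ; codegree = ≡.refl
  ; eval≈ = base }
  where
  base : ∀ R → Evaluation.IsNumerator R 1 (const (+ 1))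
  base R x = trans (*-congˡ (sym ι-1))
    (trans (solve 1 (λ x → (x :+ con (+ 1)) :* con (+ 1) := (x :+ con (+ 0)) :* con (+ 1) :+ con (+ 1)) refl x)
      (+-congʳ (*-congˡ ι-1)))
    where open OrderedField R
numerator (suc k) with numerator k
... | record { degree = d ; poly = p ; leading = c ; lead≡ = l ; codegree = g ; eval≈ = e } =
  step d p l g e
  where
  K : ℕ
  K = suc k

  length-dens : length (dens (suc K)) ≡ length (dens K) ℕ.+ length (dens K)
  length-dens = ≡.trans (length-++ (dens K)) (≡.cong (length (dens K) ℕ.+_)
    (≡.trans (length-map suc (nums K)) (length-nums≡dens k)))

  monic : ∀ {n} → length (dens K) ≡ n → Σ (Poly n) λ q → lead q ≡ + 1 ×
    (∀ R → Evaluation.IsShiftProd R q (dens K))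
  monic ≡.refl = shiftPoly (dens K) , shiftPoly-monic (dens K) , λ R → Evaluation.eval-shiftPoly R (dens K)

  step : ∀ d (p : Poly d) → lead p ≡ + suc c → length (dens K) ≡ d ℕ.+ K →
    (∀ R → Evaluation.IsNumerator R K p) →
    Numerator (suc K)
  -- `Δ` needs positive degree, and P is constant at the levels 1 and 2. Its difference vanishes
  -- there, which leaves P·ΔD alone.
  step ℕ.zero p@(const a) l g e with monic g
  ... | q , q-monic , q-eval = record
    { degree = k ; poly = p ⊠ Δ q ; leading = k ℕ.+ c ℕ.* K
    ; lead≡ = ≡.trans (lead-⊠ p (Δ q)) (≡.trans (≡.cong₂ ℤ._*_ l (≡.trans (lead-Δ q)
        (≡.trans (≡.cong (+ K ℤ.*_) q-monic) (ℤ.*-identityʳ (+ K))))) (≡.sym (ℤ.pos-* (suc c) K)))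
    ; codegree = ≡.trans length-dens (≡.trans (≡.cong₂ ℕ._+_ g g) (≡.sym (ℕ.+-suc k K)))
    ; eval≈ = eval-step }
    where
    eval-step : ∀ R → Evaluation.IsNumerator R (suc K) (p ⊠ Δ q)
    eval-step R x = trans (difference-step R K p (e R) x) (+-congˡ (begin
      ι a · (D (x + 1#) - D x) - D x · (ι a - ι a)
        ≈⟨ solve 3 (λ a D D′ → a :* (D′ :- D) :- D :* (a :- a) := a :* (D′ :- D)) refl (ι a) (D x) (D (x + 1#)) ⟩
      ι a · (D (x + 1#) - D x)
        ≈⟨ *-congˡ (+-cong (trans (sym (q-eval R (x + 1#))) (eval-Δ q x)) (-‿cong (sym (q-eval R x)))) ⟩
      ι a · (eval q x + eval (Δ q) x - eval q x)
        ≈⟨ solve 3 (λ a q d → a :* (q :+ d :- q) := a :* d) refl (ι a) (eval q x) (eval (Δ q) x) ⟩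
      ι a · eval (Δ q) x ≈⟨ sym (eval-⊠ p (Δ q) x) ⟩
      eval (p ⊠ Δ q) x ∎))
      where
      open OrderedField R
      open Evaluation R
      open SetoidReasoning setoid
      D : Carrier → Carrier
      D = shiftProd (dens K)
  step (suc d) p l g e with monic (≡.trans g (≡.cong suc (ℕ.+-suc d k)))
  ... | q , q-monic , q-eval = record
    { degree = suc d ℕ.+ (suc d ℕ.+ k) ; poly = r ; leading = k ℕ.+ c ℕ.* K
    ; lead≡ = lead-r
    ; codegree = ≡.trans length-dens (≡.trans (≡.cong₂ ℕ._+_ g g) codegree′)
    ; eval≈ = eval-step }
    where
    degrees : suc (suc d ℕ.+ k) ℕ.+ d ≡ suc d ℕ.+ (suc d ℕ.+ k)
    degrees = ≡.trans (≡.cong (ℕ._+ d) (≡.sym (ℕ.+-suc (suc d) k)))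
      (≡.trans (ℕ.+-comm (suc d ℕ.+ K) d) (≡.trans (≡.cong (λ t → d ℕ.+ t) (ℕ.+-suc (suc d) k)) (ℕ.+-suc d (suc d ℕ.+ k))))

    codegree′ : (suc d ℕ.+ K) ℕ.+ (suc d ℕ.+ K) ≡ suc d ℕ.+ (suc d ℕ.+ k) ℕ.+ suc K
    codegree′ = ℕ-solve 2 (λ d k → (d :+ (con 1 :+ k)) :+ (d :+ (con 1 :+ k)) := d :+ (d :+ k) :+ (con 1 :+ (con 1 :+ k))) ≡.refl (suc d) k
      where
      open ℕSolver.+-*-Solver using (_:+_; _:=_; con) renaming (solve to ℕ-solve)

    r₂ : Poly (suc (suc d ℕ.+ k) ℕ.+ d)
    r₂ = scale -[1+ 0 ] (q ⊠ Δ p)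

    r : Poly (suc d ℕ.+ (suc d ℕ.+ k))
    r = (p ⊠ Δ q) ⊞ ≡.subst Poly degrees r₂

    lead-r : lead r ≡ + suc (k ℕ.+ c ℕ.* K)
    lead-r = begin
      lead r                                                  ≡⟨ lead-⊞ (p ⊠ Δ q) (≡.subst Poly degrees r₂) ⟩
      lead (p ⊠ Δ q) ℤ.+ lead (≡.subst Poly degrees r₂)       ≡⟨ ≡.cong₂ ℤ._+_ (≡.trans (lead-⊠ p (Δ q)) (≡.cong (lead p ℤ.*_) (lead-Δ q)))
            (≡.trans (lead-subst degrees r₂) (≡.trans (lead-scale -[1+ 0 ] (q ⊠ Δ p))
              (≡.cong (-[1+ 0 ] ℤ.*_) (≡.trans (lead-⊠ q (Δ p)) (≡.cong (lead q ℤ.*_) (lead-Δ p)))))) ⟩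
      lead p ℤ.* (+ suc (suc d ℕ.+ k) ℤ.* lead q) ℤ.+ -[1+ 0 ] ℤ.* (lead q ℤ.* (+ suc d ℤ.* lead p))
            ≡⟨ ≡.cong₂ (λ a b → a ℤ.* (+ suc (suc d ℕ.+ k) ℤ.* b) ℤ.+ -[1+ 0 ] ℤ.* (b ℤ.* (+ suc d ℤ.* a))) l q-monic ⟩
      + suc c ℤ.* (+ suc (suc d ℕ.+ k) ℤ.* + 1) ℤ.+ -[1+ 0 ] ℤ.* (+ 1 ℤ.* (+ suc d ℤ.* + suc c))
            ≡⟨ solve 3 (λ c d k → c :* ((con (+ 1) :+ (d :+ k)) :* con (+ 1)) :+ con -[1+ 0 ] :* (con (+ 1) :* (d :* c))
                 := c :* (con (+ 1) :+ k)) ≡.refl (+ suc c) (+ suc d) (+ k) ⟩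
      + suc c ℤ.* + K                                         ≡⟨ ≡.sym (ℤ.pos-* (suc c) K) ⟩
      + suc (k ℕ.+ c ℕ.* K)                                   ∎
      where
      open ≡.≡-Reasoning
      open +-*-Solver

    eval-step : ∀ R → Evaluation.IsNumerator R (suc K) r
    eval-step R x = trans (difference-step R K p (e R) x) (+-congˡ (begin
      eval p x · (D (x + 1#) - D x) - D x · (eval p (x + 1#) - eval p x)
        ≈⟨ +-cong (*-congˡ (+-cong (trans (sym (q-eval R (x + 1#))) (eval-Δ q x)) (-‿cong (sym (q-eval R x)))))
                  (-‿cong (*-cong (sym (q-eval R x)) (+-congʳ (eval-Δ p x)))) ⟩
      P · (Q + Q′ - Q) - Q · (P + P′ - P)
        ≈⟨ solve 4 (λ P Q P′ Q′ → P :* (Q :+ Q′ :- Q) :- Q :* (P :+ P′ :- P) := P :* Q′ :+ con -[1+ 0 ] :* (Q :* P′)) refl P Q P′ Q′ ⟩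
      P · Q′ + ι -[1+ 0 ] · (Q · P′)
        ≈⟨ +-cong (sym (eval-⊠ p (Δ q) x)) (sym (trans (eval-subst R degrees r₂ x)
             (trans (eval-scale -[1+ 0 ] (q ⊠ Δ p) x) (*-congˡ (eval-⊠ q (Δ p) x))))) ⟩
      eval (p ⊠ Δ q) x + eval (≡.subst Poly degrees r₂) x
        ≈⟨ sym (eval-⊞ (p ⊠ Δ q) _ x) ⟩
      eval r x ∎))
      where
      open OrderedField R
      open Evaluation R
      open SetoidReasoning setoid
      D : Carrier → Carrier
      D = shiftProd (dens K)
      P Q P′ Q′ : Carrier
      P  = eval p x
      Q  = eval q x
      P′ = eval (Δ p) x
      Q′ = eval (Δ q) x

-- Ratios of shifted products and their expansions

-- Entries may repeat but never go back in the list, so the tail of a tuple lives at or after its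
-- head. The enumeration is lexicographic, which is the order in which `value` will decrease.
tuples : ∀ {A : Set} → ℕ → List A → List (List A)
tuples ℕ.zero  xs       = [] ∷ []
tuples (suc r) []       = []
tuples (suc r) (x ∷ xs) = map (x ∷_) (tuples r (x ∷ xs)) ++ tuples (suc r) xs

module Squeezing (R : RealNumbers) where
  open OrderedField R
  open Evaluation R
  open SetoidReasoning setoid

  ratio : ℕ → Carrier → Carrier
  ratio k y = shiftProd (nums k) y · (shiftProd (dens k) y) ⁻¹

  value : ℕ → List Carrier → Carrier
  value k []      = 1#
  value k (y ∷ τ) = ratio k y · value (suc k) τ

  ratio-Pos : ∀ k {y} → Pos y → Pos (ratio k y)
  ratio-Pos k p = Pos-· (shiftProd-Pos (nums k) p) (⁻¹-Pos (shiftProd-Pos (dens k) p))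

  ratio-· : ∀ k {y} → Pos y → ratio k y · shiftProd (dens k) y ≈ shiftProd (nums k) y
  ratio-· k {y} p = begin
    N · D ⁻¹ · D     ≈⟨ *-assoc N _ D ⟩
    N · (D ⁻¹ · D)   ≈⟨ *-congˡ (trans (*-comm _ D) (⁻¹-inverse-Pos (shiftProd-Pos (dens k) p))) ⟩
    N · 1#           ≈⟨ *-identityʳ N ⟩
    N                ∎
    where
    N D : Carrier
    N = shiftProd (nums k) y
    D = shiftProd (dens k) y

  -- Each factor (y + j)u equals 1 + ju. This bound has no error term, unlike `eval-asymptotics`, so
  -- it may serve as a denominator.
  shiftProd-lower : ∀ js {y u} → y · u ≈ 1# → Pos u → ι (+ 1) ≼ shiftProd js y · u ^ length js
  shiftProd-lower []       yu u>0 = ≈⇒≼ (trans ι-1 (sym (*-identityˡ 1#)))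
  shiftProd-lower (j ∷ js) {y} {u} yu u>0 = ≼-by
    (Nonneg-+ (≼-diff IH) (Nonneg-· (Nonneg-· (ι-Nonneg j) (inj₁ u>0)) (Nonneg-resp refl P≥0)))
    (trans (solve 4 (λ y j u P → P :- con (+ 1) :+ j :* u :* P := (con (+ 1) :+ j :* u) :* P :- con (+ 1)) refl y (ι (+ j)) u P)
      (+-congʳ (trans (*-congʳ (+-congʳ (trans ι-1 (sym yu))))
        (solve 5 (λ y j u S w → (y :* u :+ j :* u) :* (S :* w) := ((y :+ j) :* S) :* (u :* w)) refl y (ι (+ j)) u (shiftProd js y) (u ^ length js)))))
    where
    P : Carrier
    P = shiftProd js y · u ^ length js
    IH : ι (+ 1) ≼ P
    IH = shiftProd-lower js yu u>0
    P≥0 : Nonneg P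
    P≥0 = 0≼⇒Nonneg (≼-trans (Nonneg⇒0≼ (ι-Nonneg 1)) IH)

  -- The relation G_k = 1 + (c + 1)u^k + O(u^(k+1)) with K as the constant in the O-term; writing
  -- the coefficient as a successor records its positivity.
  HasExpansion : ℕ → ℕ → ℕ → Set
  HasExpansion k c K = ∀ y u → y · u ≈ 1# → Pos u → u ≼ 1# →
    u ^ k · (ι (+ suc c) - ι (+ K) · u) ≼ ratio k y - 1# ×
    ratio k y - 1# ≼ u ^ k · (ι (+ suc c) + ι (+ K) · u)

  module _ (k : ℕ) (num : Numerator k) where
    open Numerator num

    private
      K₁ K₂ : ℕ
      K₁ = lowerNorm poly
      K₂ = lowerNorm (shiftPoly (dens k))

    -- G_k - 1 is E/D, and by `codegree` it equals u^k times the quotient of the normalised E and D.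
    -- The former lies within κ₁u of c, the latter between 1 and 1 + κ₂u. Dividing by the latter can
    -- lower the quotient by a further cκ₂u, whence κ = κ₁ + cκ₂.
    numerator-expansion : HasExpansion k leading (K₁ ℕ.+ suc leading ℕ.* K₂)
    numerator-expansion y u yu u>0 u≤1 = lower , upper
      where
      c κ κ₁ κ₂ ρ N D E D̃ Ẽ w : Carrier
      c  = ι (+ suc leading)
      κ  = ι (+ (K₁ ℕ.+ suc leading ℕ.* K₂))
      κ₁ = ι (+ K₁)
      κ₂ = ι (+ K₂)
      ρ  = ratio k y - 1#
      N  = shiftProd (nums k) y
      D  = shiftProd (dens k) y
      E  = eval poly y
      D̃  = D · u ^ length (dens k)
      Ẽ  = E · u ^ degree
      w  = u ^ k

      y>0 : Pos y
      y>0 = ·-cancel-Pos u>0 (Pos-resp (sym yu) 0<1)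

      κ≈ : κ ≈ κ₁ + c · κ₂
      κ≈ = trans (ι-+ (+ K₁) (+ (suc leading ℕ.* K₂))) (+-congˡ
        (trans (reflexive (≡.cong ι (ℤ.pos-* (suc leading) K₂))) (ι-* (+ suc leading) (+ K₂))))

      D̃≥1 : ι (+ 1) ≼ D̃
      D̃≥1 = shiftProd-lower (dens k) yu u>0

      D̃>0 : Pos D̃
      D̃>0 = Pos-≼ (ι-Pos 0) D̃≥1

      D̃-upper : D̃ ≼ ι (+ 1) + κ₂ · u
      D̃-upper = ≼-resp (*-congʳ (eval-shiftPoly (dens k) y))
        (+-congʳ (reflexive (≡.cong ι (shiftPoly-monic (dens k)))))
        (proj₂ (eval-asymptotics (shiftPoly (dens k)) yu u>0 u≤1))

      Ẽ-bounds : ι (lead poly) - κ₁ · u ≼ Ẽ × Ẽ ≼ ι (lead poly) + κ₁ · u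
      Ẽ-bounds = eval-asymptotics poly yu u>0 u≤1

      lead≈ : ι (lead poly) ≈ c
      lead≈ = reflexive (≡.cong ι lead≡)

      Ẽ-lower : c - κ₁ · u ≼ Ẽ
      Ẽ-lower = ≼-resp (+-congʳ lead≈) refl (proj₁ Ẽ-bounds)

      Ẽ-upper : Ẽ ≼ c + κ₁ · u
      Ẽ-upper = ≼-resp refl (+-congʳ lead≈) (proj₂ Ẽ-bounds)

      ρ·D̃ : ρ · D̃ ≈ w · Ẽ
      ρ·D̃ = begin
        (ratio k y - 1#) · (D · u ^ length (dens k))
          ≈⟨ *-cong (+-congˡ (-‿cong (sym ι-1))) (*-congˡ (trans (reflexive (≡.cong (u ^_) codegree)) (^-homo-* u degree k))) ⟩
        (ratio k y - ι (+ 1)) · (D · (u ^ degree · w))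
          ≈⟨ solve 4 (λ r D v w → (r :- con (+ 1)) :* (D :* (v :* w)) := (r :* D :- D) :* (v :* w)) refl (ratio k y) D (u ^ degree) w ⟩
        (ratio k y · D - D) · (u ^ degree · w)
          ≈⟨ *-congʳ (+-congʳ (trans (ratio-· k y>0) (eval≈ R y))) ⟩
        (D + E - D) · (u ^ degree · w)
          ≈⟨ solve 4 (λ D E v w → (D :+ E :- D) :* (v :* w) := w :* (E :* v)) refl D E (u ^ degree) w ⟩
        w · Ẽ ∎

      w>0 : Pos w
      w>0 = ^-Pos k u>0

      lower : w · (c - κ · u) ≼ ρ
      lower = ≼-intro (·-cancel-Nonneg D̃>0 (Nonneg-resp eq
        (Nonneg-· (inj₁ w>0) (Nonneg-+ (≼-diff Ẽ-lower) (Nonneg-+ (Nonneg-· (ι-Nonneg (suc leading)) (≼-diff D̃-upper))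
          (Nonneg-· (Nonneg-· (Nonneg-+ (ι-Nonneg K₁) (Nonneg-· (ι-Nonneg (suc leading)) (ι-Nonneg K₂))) (inj₁ u>0)) (≼-diff D̃≥1)))))))
        where
        eq : w · ((Ẽ - (c - κ₁ · u)) + (c · ((ι (+ 1) + κ₂ · u) - D̃) + ((κ₁ + c · κ₂) · u) · (D̃ - ι (+ 1))))
             ≈ (ρ - w · (c - κ · u)) · D̃
        eq = begin
          w · ((Ẽ - (c - κ₁ · u)) + (c · ((ι (+ 1) + κ₂ · u) - D̃) + ((κ₁ + c · κ₂) · u) · (D̃ - ι (+ 1))))
            ≈⟨ solve 7 (λ w E c a b u D → w :* ((E :- (c :- a :* u)) :+ (c :* ((con (+ 1) :+ b :* u) :- D) :+ ((a :+ c :* b) :* u) :* (D :- con (+ 1))))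
                 := w :* E :- w :* (c :- (a :+ c :* b) :* u) :* D) refl w Ẽ c κ₁ κ₂ u D̃ ⟩
          w · Ẽ - w · (c - (κ₁ + c · κ₂) · u) · D̃
            ≈⟨ +-cong (sym ρ·D̃) (-‿cong (*-congʳ (*-congˡ (+-congˡ (-‿cong (*-congʳ (sym κ≈))))))) ⟩
          ρ · D̃ - w · (c - κ · u) · D̃
            ≈⟨ solve 3 (λ r s D → r :* D :- s :* D := (r :- s) :* D) refl ρ (w · (c - κ · u)) D̃ ⟩
          (ρ - w · (c - κ · u)) · D̃ ∎

      upper : ρ ≼ w · (c + κ · u)
      upper = ≼-trans sharp (≼-by (Nonneg-· (inj₁ w>0) (Nonneg-· (Nonneg-· (ι-Nonneg (suc leading)) (ι-Nonneg K₂)) (inj₁ u>0)))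
        (trans (solve 5 (λ w c a b u → w :* ((c :* b) :* u) := w :* (c :+ (a :+ c :* b) :* u) :- w :* (c :+ a :* u)) refl w c κ₁ κ₂ u)
          (+-congʳ (*-congˡ (+-congˡ (*-congʳ (sym κ≈)))))))
        where
        eq : w · ((c + κ₁ · u) · (D̃ - ι (+ 1)) + ((c + κ₁ · u) - Ẽ)) ≈ (w · (c + κ₁ · u) - ρ) · D̃
        eq = begin
          w · ((c + κ₁ · u) · (D̃ - ι (+ 1)) + ((c + κ₁ · u) - Ẽ))
            ≈⟨ solve 4 (λ w s D E → w :* (s :* (D :- con (+ 1)) :+ (s :- E)) := w :* s :* D :- w :* E) refl w (c + κ₁ · u) D̃ Ẽ ⟩
          w · (c + κ₁ · u) · D̃ - w · Ẽ     ≈⟨ +-congˡ (-‿cong (sym ρ·D̃)) ⟩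
          w · (c + κ₁ · u) · D̃ - ρ · D̃     ≈⟨ solve 3 (λ r s D → s :* D :- r :* D := (s :- r) :* D) refl ρ (w · (c + κ₁ · u)) D̃ ⟩
          (w · (c + κ₁ · u) - ρ) · D̃       ∎

        sharp : ρ ≼ w · (c + κ₁ · u)
        sharp = ≼-intro (·-cancel-Nonneg D̃>0 (Nonneg-resp eq (Nonneg-· (inj₁ w>0)
          (Nonneg-+ (Nonneg-· (Nonneg-+ (ι-Nonneg (suc leading)) (Nonneg-· (ι-Nonneg K₁) (inj₁ u>0))) (≼-diff D̃≥1))
            (≼-diff Ẽ-upper)))))

-- One level against the product of all later levels

tailBound : ℕ → ℕ → ℕ → ℕ
tailBound c K B = K ℕ.+ B ℕ.* (suc (suc c) ℕ.+ K)

module LevelStep (R : RealNumbers) (k c K B : ℕ) (expansion : Squeezing.HasExpansion R (suc k) c K) where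
  open OrderedField R
  open Squeezing R
  open SetoidReasoning setoid

  private
    γ γ⁻ κ κ₂ β : Carrier
    γ  = ι (+ suc c)
    γ⁻ = ι (+ c)
    κ  = ι (+ K)
    κ₂ = ι (+ tailBound c K B)
    β  = ι (+ B)

    γ≈ : γ ≈ ι (+ 1) + γ⁻
    γ≈ = ι-+ (+ 1) (+ c)

    κ₂≈ : κ₂ ≈ κ + β · (ι (+ 1) + γ + κ)
    κ₂≈ = trans (ι-+ (+ K) (+ (B ℕ.* (suc (suc c) ℕ.+ K)))) (+-congˡ
      (trans (reflexive (≡.cong ι (ℤ.pos-* B (suc (suc c) ℕ.+ K)))) (trans (ι-* (+ B) (+ (suc (suc c) ℕ.+ K)))
        (*-congˡ (trans (ι-+ (+ suc (suc c)) (+ K)) (+-congʳ (ι-+ (+ 1) (+ suc c))))))))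

    γ≥0 : Nonneg γ
    γ≥0 = ι-Nonneg (suc c)
    κ≥0 : Nonneg κ
    κ≥0 = ι-Nonneg K
    κ₂≥0 : Nonneg κ₂
    κ₂≥0 = ι-Nonneg (tailBound c K B)
    β≥0 : Nonneg β
    β≥0 = ι-Nonneg B

  ratio≥1 : ∀ {y u} → y · u ≈ 1# → Pos u → u ≼ 1# → κ · u ≼ 1# → 1# ≼ ratio (suc k) y
  ratio≥1 {y} {u} yu u>0 u≤1 κu≤1 = ≼-intro (0≼⇒Nonneg (≼-trans
    (Nonneg⇒0≼ (Nonneg-· (inj₁ (^-Pos (suc k) u>0)) (Nonneg-resp
      (trans (solve 3 (λ g l m → m :- l :+ g := m :+ g :- l) refl γ⁻ (κ · u) 1#)
        (+-congʳ (trans (+-congʳ (sym ι-1)) (sym γ≈))))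
      (Nonneg-+ (≼-diff κu≤1) (ι-Nonneg c)))))
    (proj₁ (expansion y u yu u>0 u≤1))))

  -- Let w = u^(k+1). Multiplying 1 + w(γ + κu) by 1 + βuw adds βuw(1 + w(γ + κu)), which is at most
  -- β(1 + γ + κ)uw because u and w are at most 1. This is the second summand of `tailBound`.
  ratio-upper : ∀ {y u} → y · u ≈ 1# → Pos u → u ≼ 1# →
    ratio (suc k) y · (1# + β · u ^ suc (suc k)) ≼ 1# + u ^ suc k · (γ + κ₂ · u)
  ratio-upper {y} {u} yu u>0 u≤1 = ≼-by
    (Nonneg-+ (Nonneg-· (≼-diff (proj₂ (expansion y u yu u>0 u≤1))) 1+b≥0)
      (Nonneg-· (Nonneg-· (Nonneg-· β≥0 u≥0) w≥0)
        (Nonneg-+ (Nonneg-· γ≥0 1-w≥0) (Nonneg-· κ≥0 (Nonneg-+ 1-w≥0 (Nonneg-· w≥0 1-u≥0))))))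
    (begin
      (w · (γ + κ · u) - (ratio (suc k) y - 1#)) · (1# + β · (u · w)) +
        β · u · w · (γ · (ι (+ 1) - w) + κ · ((ι (+ 1) - w) + w · (ι (+ 1) - u)))
        ≈⟨ +-congʳ (*-cong (+-congˡ (-‿cong (+-congˡ (-‿cong (sym ι-1))))) (+-congʳ (sym ι-1))) ⟩
      (w · (γ + κ · u) - (ratio (suc k) y - ι (+ 1))) · (ι (+ 1) + β · (u · w)) +
        β · u · w · (γ · (ι (+ 1) - w) + κ · ((ι (+ 1) - w) + w · (ι (+ 1) - u)))
        ≈⟨ solve 6 (λ w g κ u r b →
             (w :* (g :+ κ :* u) :- (r :- con (+ 1))) :* (con (+ 1) :+ b :* (u :* w)) :+
               b :* u :* w :* (g :* (con (+ 1) :- w) :+ κ :* ((con (+ 1) :- w) :+ w :* (con (+ 1) :- u)))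
             := (con (+ 1) :+ w :* (g :+ (κ :+ b :* (con (+ 1) :+ g :+ κ)) :* u)) :- r :* (con (+ 1) :+ b :* (u :* w)))
             refl w γ κ u (ratio (suc k) y) β ⟩
      (ι (+ 1) + w · (γ + (κ + β · (ι (+ 1) + γ + κ)) · u)) - ratio (suc k) y · (ι (+ 1) + β · (u · w))
        ≈⟨ +-cong (+-cong ι-1 (*-congˡ (+-congˡ (*-congʳ (sym κ₂≈))))) (-‿cong (*-congˡ (+-congʳ ι-1))) ⟩
      (1# + w · (γ + κ₂ · u)) - ratio (suc k) y · (1# + β · (u · w)) ∎)
    where
    w : Carrier
    w = u ^ suc k
    u≥0 : Nonneg u
    u≥0 = inj₁ u>0
    w≥0 : Nonneg w
    w≥0 = inj₁ (^-Pos (suc k) u>0)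
    1-u≥0 : Nonneg (ι (+ 1) - u)
    1-u≥0 = ≼-diff (≼-trans u≤1 (≈⇒≼ (sym ι-1)))
    1-w≥0 : Nonneg (ι (+ 1) - w)
    1-w≥0 = ≼-diff (≼-trans (^≼1 (suc k) u>0 u≤1) (≈⇒≼ (sym ι-1)))
    1+b≥0 : Nonneg (1# + β · (u · w))
    1+b≥0 = Nonneg-+ (inj₁ 0<1) (Nonneg-· β≥0 (Nonneg-· u≥0 w≥0))

  -- Returns the product of this level and its tail to the form 1 + B·u^(k+1), so that it can be the
  -- tail of the preceding level.
  ratio-tail≤ : ∀ {y u} → y · u ≈ 1# → Pos u → u ≼ 1# →
    ratio (suc k) y · (1# + β · u ^ suc (suc k)) ≼ 1# + ι (+ (suc c ℕ.+ tailBound c K B)) · u ^ suc k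
  ratio-tail≤ {y} {u} yu u>0 u≤1 = ≼-trans (ratio-upper yu u>0 u≤1)
    (≼-by (Nonneg-· (Nonneg-· κ₂≥0 (inj₁ (^-Pos (suc k) u>0))) (≼-diff (≼-trans u≤1 (≈⇒≼ (sym ι-1)))))
      (trans (solve 5 (λ κ₂ w u g o → κ₂ :* w :* (con (+ 1) :- u) := (o :+ (g :+ κ₂) :* w) :- (o :+ w :* (g :+ κ₂ :* u)))
          refl κ₂ (u ^ suc k) u γ 1#)
        (+-congʳ (+-congˡ (*-congʳ (sym (ι-+ (+ suc c) (+ tailBound c K B))))))))

  -- The separation of the main terms and both errors have order v^(k+2), so the comparison comes
  -- down to their constants: a against κ + κ₂. The extra 1 in the bound on a makes the inequality
  -- strict.
  ratio-gap : ∀ {y y′ u v a} → y · v ≈ 1# → y′ · u ≈ 1# → Pos u → v ≼ 1# →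
    κ + κ₂ + ι (+ 1) ≼ a → u + a · (v · v) ≼ v →
    ratio (suc k) y′ · (1# + β · u ^ suc (suc k)) < ratio (suc k) y
  ratio-gap {y} {y′} {u} {v} {a} yv y′u u>0 v≤1 a-large gap =
    ≼-<-trans (ratio-upper y′u u>0 (≼-trans u≤v v≤1)) (<-≼-trans middle lower)
    where
    a≥0 : Nonneg a
    a≥0 = 0≼⇒Nonneg (≼-trans (Nonneg⇒0≼ (Nonneg-+ (Nonneg-+ κ≥0 κ₂≥0) (ι-Nonneg 1))) a-large)

    -- The sign of v is not yet known: it follows from u ≤ v, which rests on this.
    v² : Nonneg (v · v)
    v² with ≼⊎> 0# v
    ... | inj₁ p = Nonneg-· (0≼⇒Nonneg p) (0≼⇒Nonneg p)
    ... | inj₂ p = Nonneg-resp (solve 1 (λ v → (con (+ 0) :- v) :* (con (+ 0) :- v) := v :* v) refl v)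
                     (Nonneg-· (inj₁ (<⇒Pos-diff p)) (inj₁ (<⇒Pos-diff p)))

    u≤v : u ≼ v
    u≤v = ≼-trans (≼-by (Nonneg-· a≥0 v²) (solve 2 (λ u x → x := (u :+ x) :- u) refl u (a · (v · v)))) gap

    v>0 : Pos v
    v>0 = Pos-≼ u>0 u≤v

    V W : Carrier
    V = v ^ k
    W = u ^ k

    V>0 : Pos V
    V>0 = ^-Pos k v>0
    W≥0 : Nonneg W
    W≥0 = inj₁ (^-Pos k u>0)
    W≤V : Nonneg (V - W)
    W≤V = ≼-diff (^-mono k (inj₁ u>0) u≤v)
    u≥0 : Nonneg u
    u≥0 = inj₁ u>0
    v≥0 : Nonneg v
    v≥0 = inj₁ v>0

    lower : 1# + v ^ suc k · (γ - κ · v) ≼ ratio (suc k) y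
    lower = ≼-by (≼-diff (proj₁ (expansion y v yv v>0 v≤1)))
      (solve 3 (λ r o s → r :- o :- s := r :- (o :+ s)) refl (ratio (suc k) y) 1# (v ^ suc k · (γ - κ · v)))

    -- The gap contributes a v² vᵏ to v^(k+1) - u^(k+1), which dominates both error terms.
    middle : 1# + u ^ suc k · (γ + κ₂ · u) < 1# + v ^ suc k · (γ - κ · v)
    middle = <-by
      (Pos-+ (Pos-· V>0 (Pos-· v>0 v>0))
        (Nonneg-+ (Nonneg-· κ₂≥0 (Nonneg-+ (Nonneg-· W≤V (Nonneg-· v≥0 v≥0))
                                            (Nonneg-· W≥0 (Nonneg-· (≼-diff u≤v) (Nonneg-+ v≥0 u≥0)))))
          (Nonneg-+ (Nonneg-· (inj₁ V>0) (Nonneg-+ (≼-diff gap) (Nonneg-· (≼-diff a-large) (Nonneg-· v≥0 v≥0))))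
            (Nonneg-+ (Nonneg-· u≥0 W≤V)
              (Nonneg-· (ι-Nonneg c) (Nonneg-+ (Nonneg-· (inj₁ V>0) (≼-diff u≤v)) (Nonneg-· u≥0 W≤V)))))))
      (trans (solve 9 (λ V W u v a κ κ₂ g o →
          V :* (v :* v) :+ (κ₂ :* ((V :- W) :* (v :* v) :+ W :* ((v :- u) :* (v :+ u))) :+
            (V :* ((v :- (u :+ a :* (v :* v))) :+ (a :- (κ :+ κ₂ :+ con (+ 1))) :* (v :* v)) :+
              (u :* (V :- W) :+ g :* (V :* (v :- u) :+ u :* (V :- W)))))
          := (o :+ (v :* V) :* ((con (+ 1) :+ g) :- κ :* v)) :- (o :+ (u :* W) :* ((con (+ 1) :+ g) :+ κ₂ :* u)))
          refl V W u v a κ κ₂ γ⁻ 1#)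
        (+-cong (+-congˡ (*-congˡ (+-congʳ (sym γ≈)))) (-‿cong (+-congˡ (*-congˡ (+-congʳ (sym γ≈)))))))

-- Squeezing

module SpreadLists (R : RealNumbers) where
  open OrderedField R
  open Squeezing R

  Spread : Carrier → List Carrier → Set
  Spread a Y = All (a + a ≼_) Y × AllPairs (λ y y′ → y + (a + a) ≼ y′) Y

  Spread-tail : ∀ {a y Y} → Spread a (y ∷ Y) → Spread a Y
  Spread-tail (_ ∷ p , _ ∷ q) = p , q

  Decreasing : ℕ → List (List Carrier) → Set
  Decreasing k = AllPairs (λ τ τ′ → value k τ′ < value k τ)

  tailCap : ℕ → ℕ → Carrier → Carrier
  tailCap k B y = 1# + ι (+ B) · (y ⁻¹) ^ k

  TuplesDecreasing : ℕ → ℕ → ℕ → Set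
  TuplesDecreasing k r C = ∀ a → 1# ≼ a → ι (+ C) ≼ a → ∀ Y → Spread a Y → Decreasing k (tuples r Y)

  TuplesLower : ℕ → ℕ → ℕ → Set
  TuplesLower k r C = ∀ a → 1# ≼ a → ι (+ C) ≼ a → ∀ Y → Spread a Y → All (λ τ → 1# ≼ value k τ) (tuples r Y)

  TuplesUpper : ℕ → ℕ → ℕ → ℕ → Set
  TuplesUpper k r C B = ∀ a → 1# ≼ a → ι (+ C) ≼ a → ∀ y Y → Spread a (y ∷ Y) →
    All (λ τ → value k τ ≼ tailCap k B y) (tuples r (y ∷ Y))

  module _ {a y : Carrier} (1≤a : 1# ≼ a) (far : a + a ≼ y) where
    private
      a>0 : Pos a
      a>0 = Pos-≼ 0<1 1≤a

    far-Pos : Pos y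
    far-Pos = Pos-≼ (Pos-+ a>0 (inj₁ a>0)) far

    far-inverse : y · y ⁻¹ ≈ 1#
    far-inverse = ⁻¹-inverse-Pos far-Pos

    far-⁻¹>0 : Pos (y ⁻¹)
    far-⁻¹>0 = ⁻¹-Pos far-Pos

    far-·⁻¹≤1 : a · y ⁻¹ ≼ 1#
    far-·⁻¹≤1 = ≼-by (Nonneg-· (Nonneg-+ (≼-diff far) (inj₁ a>0)) (inj₁ far-⁻¹>0))
      (trans (solve 3 (λ a y u → ((y :- (a :+ a)) :+ a) :* u := y :* u :- a :* u) refl a y (y ⁻¹))
        (+-congʳ far-inverse))

    far-⁻¹≤1 : y ⁻¹ ≼ 1#
    far-⁻¹≤1 = ≼-trans (≼-by (Nonneg-· (≼-diff (≼-trans (≈⇒≼ ι-1) 1≤a)) (inj₁ far-⁻¹>0))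
      (solve 2 (λ a u → (a :- con (+ 1)) :* u := a :* u :- u) refl a (y ⁻¹))) far-·⁻¹≤1

    -- Writing y′ = y + d and clearing denominators leaves d(y - a) ≥ ay. With d ≥ 2a the left side
    -- is at least 2a(y - a), and this suffices exactly when y ≥ 2a; hence both doublings in
    -- `Spread`.
    ⁻¹-gap : ∀ {y′} → y + (a + a) ≼ y′ → y′ ⁻¹ + a · (y ⁻¹ · y ⁻¹) ≼ y ⁻¹
    ⁻¹-gap {y′} sep = ≼-by
      (Nonneg-· (Nonneg-· (inj₁ (⁻¹-Pos y′>0)) (Nonneg-· (inj₁ far-⁻¹>0) (inj₁ far-⁻¹>0)))
        (Nonneg-+ (Nonneg-· (inj₁ a>0) (≼-diff far)) (Nonneg-· (≼-diff sep) (Nonneg-+ (≼-diff far) (inj₁ a>0)))))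
      (trans (solve 5 (λ a y y′ u v →
          u :* (v :* v) :* (a :* (y :- (a :+ a)) :+ (y′ :- (y :+ (a :+ a))) :* ((y :- (a :+ a)) :+ a))
          := (y′ :* u) :* (y :* v) :* v :- ((y :* v) :* (y :* v) :* u :+ (y′ :* u) :* (a :* (v :* v)))) refl
          a y y′ (y′ ⁻¹) (y ⁻¹))
        (+-cong (one (trans (*-cong y′u far-inverse) (*-identityˡ 1#)))
          (-‿cong (+-cong (one (trans (*-cong far-inverse far-inverse) (*-identityˡ 1#))) (one y′u)))))
      where
      y′>0 : Pos y′
      y′>0 = Pos-≼ (Pos-+ far-Pos (inj₁ (Pos-+ a>0 (inj₁ a>0)))) sep
      y′u : y′ · y′ ⁻¹ ≈ 1#
      y′u = ⁻¹-inverse-Pos y′>0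
      one : ∀ {s x} → s ≈ 1# → s · x ≈ x
      one e = trans (*-congʳ e) (*-identityˡ _)

    ⁻¹-antitone : ∀ {y′} → y + (a + a) ≼ y′ → y′ ⁻¹ ≼ y ⁻¹
    ⁻¹-antitone {y′} sep = ≼-trans (≼-by (Nonneg-· (inj₁ a>0) (Nonneg-· (inj₁ far-⁻¹>0) (inj₁ far-⁻¹>0)))
      (solve 2 (λ u x → x := (u :+ x) :- u) refl (y′ ⁻¹) (a · (y ⁻¹ · y ⁻¹)))) (⁻¹-gap sep)

  -- Products over later levels stay in [1, b y], hence below the relative gaps at level k, so that
  -- the values are ordered lexicographically.
  module Squeeze (k r : ℕ) {a : Carrier} (1≤a : 1# ≼ a) (b : Carrier → Carrier)
    (tail-decreasing : ∀ Y → Spread a Y → Decreasing (suc k) (tuples r Y))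
    (tail-lower : ∀ Y → Spread a Y → All (λ τ → 1# ≼ value (suc k) τ) (tuples r Y))
    (tail-upper : ∀ y Y → Spread a (y ∷ Y) → All (λ τ → value (suc k) τ ≼ b y) (tuples r (y ∷ Y)))
    (gap : ∀ y y′ → a + a ≼ y → a + a ≼ y′ → y + (a + a) ≼ y′ → ratio k y′ · b y′ < ratio k y)
    where

    far-ratio-Pos : ∀ {y} → a + a ≼ y → Pos (ratio k y)
    far-ratio-Pos far = ratio-Pos k (far-Pos 1≤a far)

    -- The witness is the head of τ: the rest of τ starts no earlier, so `tail-upper` applies at the
    -- head.
    dominated : ∀ Y → Spread a Y →
      All (λ τ → Any (λ y → value k τ ≼ ratio k y · b y) Y) (tuples (suc r) Y)
    dominated []      _ = []
    dominated (y ∷ Y) s@(far ∷ _ , _) = All.++⁺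
      (All.map⁺ (All.map (λ p → here (·-monoˡ-≼ (inj₁ (far-ratio-Pos far)) p)) (tail-upper y Y s)))
      (All.map there (dominated Y (Spread-tail s)))

    -- Tuples with equal heads are compared by their tails. If the heads are y before y′, then value
    -- τ′ ≤ G_k(y′)b(y′) < G_k(y) ≤ value τ, the last step because tails are at least 1.
    decreasing : ∀ Y → Spread a Y → Decreasing k (tuples (suc r) Y)
    decreasing []      _ = []
    decreasing (y ∷ Y) s@(far ∷ fars , seps ∷ _) = AllPairs.++⁺
      (AllPairs.map⁺ (AllPairs.map (·-monoˡ-< (far-ratio-Pos far)) (tail-decreasing (y ∷ Y) s)))
      (decreasing Y (Spread-tail s))
      (All.map⁺ (All.map (λ {τ} → above {τ}) (tail-lower (y ∷ Y) s)))
      where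
      below : ∀ {τ Y} → All (a + a ≼_) Y → All (y + (a + a) ≼_) Y →
        Any (λ y′ → value k τ ≼ ratio k y′ · b y′) Y → value k τ < ratio k y
      below (f ∷ _) (p ∷ _) (here d)  = ≼-<-trans d (gap y _ far f p)
      below {τ} (_ ∷ f) (_ ∷ p) (there d) = below {τ} f p d

      above : ∀ {τ} → 1# ≼ value (suc k) τ →
        All (λ τ′ → value k τ′ < ratio k y · value (suc k) τ) (tuples (suc r) Y)
      above {τ} l = All.map (λ {τ′} d → <-≼-trans (below {τ′} fars seps d)
        (≼-trans (≈⇒≼ (sym (*-identityʳ _))) (·-monoˡ-≼ (inj₁ (far-ratio-Pos far)) l)))
        (dominated Y (Spread-tail s))

-- Concerns the products over the levels k, …, k + r - 1.
record Squeezed (k r : ℕ) : Set₁ where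
  field
    C B        : ℕ
    decreasing : ∀ R → SpreadLists.TuplesDecreasing R k r C
    lower      : ∀ R → SpreadLists.TuplesLower R k r C
    upper      : ∀ R → SpreadLists.TuplesUpper R k r C B

-- Induction on the number r of levels for all starting levels at once, since the tail begins one
-- level higher. All three properties are carried together: ordering the values at one level needs
-- both bounds on the tail.
squeezed : ∀ k r → Squeezed (suc k) r
squeezed k ℕ.zero = record
  { C = 0 ; B = 0
  ; decreasing = λ R a _ _ Y _ → [] ∷ []
  ; lower = λ R a _ _ Y _ → OrderedField.≼-refl R ∷ []
  ; upper = λ R a _ _ y Y _ → empty-upper R y ∷ [] }
  where
  empty-upper : ∀ R y → OrderedField._≼_ R (Squeezing.value R (suc k) []) (SpreadLists.tailCap R (suc k) 0 y)
  empty-upper R y = ≈⇒≼ (sym (trans (+-congˡ (zeroˡ _)) (+-identityʳ 1#)))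
    where open OrderedField R
squeezed k (suc r) = record
  { C = C ; B = suc c ℕ.+ tailBound c K B₁
  ; decreasing = λ R a 1≤a C≤a → Real.decreasing R 1≤a C≤a
  ; lower = λ R a 1≤a C≤a → Real.lower R 1≤a C≤a
  ; upper = λ R a 1≤a C≤a → Real.upper R 1≤a C≤a }
  where
  module Next = Squeezed (squeezed (suc k) r)
  num : Numerator (suc k)
  num = numerator k
  c K B₁ C : ℕ
  c  = Numerator.leading num
  K  = lowerNorm (Numerator.poly num) ℕ.+ suc c ℕ.* lowerNorm (shiftPoly (dens (suc k)))
  B₁ = Next.B
  -- `Next.C` serves the tail, and the bracket is the lower bound on a in `ratio-gap`. It also
  -- yields K ≤ a, which keeps the ratio at least 1.
  C  = Next.C ℕ.+ (K ℕ.+ tailBound c K B₁ ℕ.+ 1)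

  module Real (R : RealNumbers) {a : RealNumbers.Carrier R}
    (1≤a : OrderedField._≼_ R (RealNumbers.1# R) a) (C≤a : OrderedField._≼_ R (OrderedField.ι R (+ C)) a) where
    open OrderedField R
    open Squeezing R
    open SpreadLists R
    open LevelStep R k c K B₁ (numerator-expansion (suc k) num)

    C₁≤a : ι (+ Next.C) ≼ a
    C₁≤a = ≼-trans (ιℕ-mono (ℕ.m≤m+n Next.C _)) C≤a

    sum≤a : ι (+ K) + ι (+ tailBound c K B₁) + ι (+ 1) ≼ a
    sum≤a = ≼-trans (≈⇒≼ (sym (trans (ι-+ (+ (K ℕ.+ tailBound c K B₁)) (+ 1)) (+-congʳ (ι-+ (+ K) (+ tailBound c K B₁))))))
      (≼-trans (ιℕ-mono (ℕ.m≤n+m _ Next.C)) C≤a)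

    K≤a : ι (+ K) ≼ a
    K≤a = ≼-trans (ιℕ-mono (ℕ.≤-trans (ℕ.m≤m+n K _) (ℕ.≤-trans (ℕ.m≤m+n (K ℕ.+ _) 1) (ℕ.m≤n+m _ Next.C)))) C≤a

    open Squeeze (suc k) r 1≤a (λ y → 1# + ι (+ B₁) · (y ⁻¹) ^ suc (suc k))
      (Next.decreasing R a 1≤a C₁≤a) (Next.lower R a 1≤a C₁≤a) (Next.upper R a 1≤a C₁≤a)
      (λ y y′ f f′ p → ratio-gap (far-inverse 1≤a f) (far-inverse 1≤a f′) (far-⁻¹>0 1≤a f′) (far-⁻¹≤1 1≤a f)
        sum≤a (⁻¹-gap 1≤a f p)) public

    lower : ∀ Y → Spread a Y → All (λ τ → 1# ≼ value (suc k) τ) (tuples (suc r) Y)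
    lower []      _ = []
    lower (y ∷ Y) s@(f ∷ _ , _) = All.++⁺
      (All.map⁺ (All.map (λ l → ≼-trans (≈⇒≼ (sym (*-identityˡ 1#)))
          (·-mono-≼ (inj₁ 0<1) (0≼⇒Nonneg (≼-trans (<⇒≼ 0<1) l))
          (ratio≥1 (far-inverse 1≤a f) (far-⁻¹>0 1≤a f) (far-⁻¹≤1 1≤a f)
            (≼-trans (≼-resp (*-comm _ _) (*-comm _ _) (·-monoˡ-≼ (inj₁ (far-⁻¹>0 1≤a f)) K≤a)) (far-·⁻¹≤1 1≤a f))) l))
        (Next.lower R a 1≤a C₁≤a (y ∷ Y) s)))
      (lower Y (Spread-tail s))

    upper : ∀ y Y → Spread a (y ∷ Y) →
      All (λ τ → value (suc k) τ ≼ 1# + ι (+ (suc c ℕ.+ tailBound c K B₁)) · (y ⁻¹) ^ suc k) (tuples (suc r) (y ∷ Y))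
    upper y Y s@(f ∷ fs , ps ∷ _) = All.map (λ {τ} → bound {τ} (f ∷ fs) (≼-refl ∷ All.zipWith (λ (f′ , p) → ⁻¹-antitone 1≤a f p) (fs , ps)))
      (dominated (y ∷ Y) s)
      where
      bound : ∀ {τ Z} → All (a + a ≼_) Z → All (λ z → z ⁻¹ ≼ y ⁻¹) Z →
        Any (λ z → value (suc k) τ ≼ ratio (suc k) z · (1# + ι (+ B₁) · (z ⁻¹) ^ suc (suc k))) Z →
        value (suc k) τ ≼ 1# + ι (+ (suc c ℕ.+ tailBound c K B₁)) · (y ⁻¹) ^ suc k
      bound (f ∷ _) (p ∷ _) (here d)  = ≼-trans d (≼-trans
        (ratio-tail≤ (far-inverse 1≤a f) (far-⁻¹>0 1≤a f) (far-⁻¹≤1 1≤a f))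
        (+-mono-≼ ≼-refl (·-monoˡ-≼ (ι-Nonneg (suc c ℕ.+ tailBound c K B₁)) (^-mono (suc k) (inj₁ (far-⁻¹>0 1≤a f)) p))))
      bound {τ} (_ ∷ f) (_ ∷ p) (there d) = bound {τ} f p d

ReciprocalSqueezed : ℕ → ℕ → Set₁
ReciprocalSqueezed r C = ∀ R → SpreadLists.TuplesDecreasing R 0 (suc r) C

-- Level 0 stands apart because 1/y is not close to 1. Here v - u ≥ av² has to beat the tail excess
-- βu², so a ≥ 1 + β is enough; no bounds on the values are needed, as no level precedes this one.
reciprocal-squeezed : ∀ r → Σ ℕ (ReciprocalSqueezed r)
reciprocal-squeezed r = Next.C ℕ.+ suc Next.B , λ R a → Real.result R {a}
  where
  module Next = Squeezed (squeezed 0 r)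
  module Real (R : RealNumbers) {a : RealNumbers.Carrier R} where
    open OrderedField R
    open Squeezing R
    open SpreadLists R
    open SetoidReasoning setoid

    result : 1# ≼ a → ι (+ (Next.C ℕ.+ suc Next.B)) ≼ a → ∀ Y → Spread a Y → Decreasing 0 (tuples (suc r) Y)
    result 1≤a C≤a = Squeeze.decreasing 0 r 1≤a (λ y → 1# + β · (y ⁻¹) ^ 1)
      (Next.decreasing R a 1≤a C₁≤a) (Next.lower R a 1≤a C₁≤a) (Next.upper R a 1≤a C₁≤a) gap
      where
      β : Carrier
      β = ι (+ Next.B)

      C₁≤a : ι (+ Next.C) ≼ a
      C₁≤a = ≼-trans (ιℕ-mono (ℕ.m≤m+n Next.C _)) C≤a

      B<a : 1# + β ≼ a
      B<a = ≼-trans (ιℕ-mono (ℕ.m≤n+m (suc Next.B) Next.C)) C≤a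

      ratio₀ : ∀ {y} → a + a ≼ y → ratio 0 y ≈ y ⁻¹
      ratio₀ {y} f = ·-cancelʳ (Pos⇒≉0 (far-Pos 1≤a f)) (begin
        ratio 0 y · y                        ≈⟨ *-congˡ (sym (trans (*-identityʳ _) (+-identityʳ y))) ⟩
        ratio 0 y · ((y + 0#) · 1#)          ≈⟨ ratio-· 0 (far-Pos 1≤a f) ⟩
        1#                                   ≈⟨ sym (far-inverse 1≤a f) ⟩
        y · y ⁻¹                             ≈⟨ *-comm y _ ⟩
        y ⁻¹ · y                             ∎)

      gap : ∀ y y′ → a + a ≼ y → a + a ≼ y′ → y + (a + a) ≼ y′ →
        ratio 0 y′ · (1# + β · (y′ ⁻¹) ^ 1) < ratio 0 y
      gap y y′ f f′ p = <-respˡ-≈ (*-congʳ (sym (ratio₀ f′))) (<-respʳ-≈ (sym (ratio₀ f)) (<-by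
        (Pos-+ (Pos-· v>0 v>0) (Nonneg-+ (≼-diff (⁻¹-gap 1≤a f p))
          (Nonneg-+ (Nonneg-· (≼-diff (≼-trans (≈⇒≼ (+-congʳ ι-1)) B<a)) (Nonneg-· (inj₁ v>0) (inj₁ v>0)))
            (Nonneg-· (ι-Nonneg Next.B) (Nonneg-· (≼-diff (⁻¹-antitone 1≤a f p)) (Nonneg-+ (inj₁ v>0) (inj₁ u>0)))))))
        (trans (solve 4 (λ u v a β → v :* v :+ ((v :- (u :+ a :* (v :* v))) :+ ((a :- (con (+ 1) :+ β)) :* (v :* v) :+ β :* ((v :- u) :* (v :+ u))))
            := v :- u :* (con (+ 1) :+ β :* (u :* con (+ 1)))) refl (y′ ⁻¹) (y ⁻¹) a β)
          (+-congˡ (-‿cong (*-congˡ (+-cong ι-1 (*-congˡ (*-congˡ ι-1)))))))))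
        where
        v>0 : Pos (y ⁻¹)
        v>0 = far-⁻¹>0 1≤a f
        u>0 : Pos (y′ ⁻¹)
        u>0 = far-⁻¹>0 1≤a f′

-- Counting

-- The mean value bound for x^(r+1) on [n, n + 1], in the form that matches the recursion of
-- `tuples`.
suc^-upper : ∀ n r → suc n ℕ.^ suc r ℕ.≤ suc r ℕ.* suc n ℕ.^ r ℕ.+ n ℕ.^ suc r
suc^-upper n ℕ.zero = ℕ.≤-reflexive (solve 1 (λ n → (con 1 :+ n) :* con 1 := con 1 :* con 1 :+ n :* con 1) ≡.refl n)
  where open ℕSolver.+-*-Solver
suc^-upper n (suc r) = begin
  suc n ℕ.* suc n ℕ.^ suc r                                    ≤⟨ ℕ.*-monoʳ-≤ (suc n) (suc^-upper n r) ⟩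
  suc n ℕ.* (suc r ℕ.* suc n ℕ.^ r ℕ.+ n ℕ.^ suc r)
    ≡⟨ solve 4 (λ n r p q → (con 1 :+ n) :* ((con 1 :+ r) :* p :+ q) := (con 1 :+ r) :* ((con 1 :+ n) :* p) :+ q :+ n :* q)
         ≡.refl n r (suc n ℕ.^ r) (n ℕ.^ suc r) ⟩
  suc r ℕ.* suc n ℕ.^ suc r ℕ.+ n ℕ.^ suc r ℕ.+ n ℕ.^ suc (suc r)
    ≤⟨ ℕ.+-monoˡ-≤ (n ℕ.^ suc (suc r)) (ℕ.+-monoʳ-≤ (suc r ℕ.* suc n ℕ.^ suc r) (ℕ.^-monoˡ-≤ (suc r) (ℕ.n≤1+n n))) ⟩
  suc r ℕ.* suc n ℕ.^ suc r ℕ.+ suc n ℕ.^ suc r ℕ.+ n ℕ.^ suc (suc r)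
    ≡⟨ ≡.cong (ℕ._+ n ℕ.^ suc (suc r)) (ℕ.+-comm (suc r ℕ.* suc n ℕ.^ suc r) _) ⟩
  suc (suc r) ℕ.* suc n ℕ.^ suc r ℕ.+ n ℕ.^ suc (suc r)        ∎
  where
  open ℕ.≤-Reasoning
  open ℕSolver.+-*-Solver

module _ {A : Set} where

  -- The tuples are multisets, and each has at most r! orderings.
  length-tuples : ∀ r (xs : List A) → length xs ℕ.^ r ℕ.≤ r ! ℕ.* length (tuples r xs)
  length-tuples ℕ.zero  xs = ℕ.≤-refl
  length-tuples (suc r) [] = ℕ.z≤n
  length-tuples (suc r) (x ∷ xs) = begin
    suc n ℕ.^ suc r                                       ≤⟨ suc^-upper n r ⟩
    suc r ℕ.* suc n ℕ.^ r ℕ.+ n ℕ.^ suc r                 ≤⟨ ℕ.+-mono-≤ (ℕ.*-monoʳ-≤ (suc r) (length-tuples r (x ∷ xs))) (length-tuples (suc r) xs) ⟩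
    suc r ℕ.* (r ! ℕ.* length (tuples r (x ∷ xs))) ℕ.+ suc r ! ℕ.* length (tuples (suc r) xs)
      ≡⟨ solve 4 (λ r f a b → (con 1 :+ r) :* (f :* a) :+ ((con 1 :+ r) :* f) :* b := ((con 1 :+ r) :* f) :* (a :+ b)) ≡.refl
           r (r !) (length (tuples r (x ∷ xs))) (length (tuples (suc r) xs)) ⟩
    suc r ! ℕ.* (length (tuples r (x ∷ xs)) ℕ.+ length (tuples (suc r) xs))
      ≡⟨ ≡.cong (suc r ! ℕ.*_) (≡.sym (≡.trans (length-++ (map (x ∷_) (tuples r (x ∷ xs))))
           (≡.cong (ℕ._+ _) (length-map (x ∷_) (tuples r (x ∷ xs)))))) ⟩
    suc r ! ℕ.* length (tuples (suc r) (x ∷ xs))          ∎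
    where
    open ℕ.≤-Reasoning
    open ℕSolver.+-*-Solver
    n : ℕ
    n = length xs

  tuples-All : ∀ {P : A → Set} r {xs} → All P xs → All (All P) (tuples r xs)
  tuples-All ℕ.zero  ps       = [] ∷ []
  tuples-All (suc r) []       = []
  tuples-All (suc r) (p ∷ ps) = All.++⁺ (All.map⁺ (All.map (p ∷_) (tuples-All r (p ∷ ps)))) (tuples-All (suc r) ps)

  tuples-length : ∀ r (xs : List A) → All (λ τ → length τ ≡ r) (tuples r xs)
  tuples-length ℕ.zero  xs       = ≡.refl ∷ []
  tuples-length (suc r) []       = []
  tuples-length (suc r) (x ∷ xs) = All.++⁺ (All.map⁺ (All.map (≡.cong suc) (tuples-length r (x ∷ xs)))) (tuples-length (suc r) xs)

  length-cartesianProduct : ∀ {B : Set} (xs : List A) (ys : List B) →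
    length (cartesianProduct xs ys) ≡ length xs ℕ.* length ys
  length-cartesianProduct []       ys = ≡.refl
  length-cartesianProduct (x ∷ xs) ys = ≡.trans (length-++ (map (x ,_) ys))
    (≡.cong₂ ℕ._+_ (length-map (x ,_) ys) (length-cartesianProduct xs ys))

  cartesianProduct-All : ∀ {B : Set} {P : A → Set} {Q : B → Set} {xs ys} → All P xs → All Q ys →
    All (λ p → P (proj₁ p) × Q (proj₂ p)) (cartesianProduct xs ys)
  cartesianProduct-All []       qs = []
  cartesianProduct-All (p ∷ ps) qs = All.++⁺ (All.map⁺ (All.map (p ,_) qs)) (cartesianProduct-All ps qs)

  cartesianProduct-AllPairs : ∀ {B : Set} {R : A → A → Set} {S : B → B → Set} {xs ys} →
    AllPairs R xs → AllPairs S ys →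
    AllPairs (λ p q → (proj₁ p ≡ proj₁ q × S (proj₂ p) (proj₂ q)) ⊎ R (proj₁ p) (proj₁ q)) (cartesianProduct xs ys)
  cartesianProduct-AllPairs []       ss = []
  cartesianProduct-AllPairs {ys = ys} (r ∷ rs) ss = AllPairs.++⁺
    (AllPairs.map⁺ (AllPairs.map (λ s → inj₁ (≡.refl , s)) ss))
    (cartesianProduct-AllPairs rs ss)
    -- The equation on 0 is a trivially true predicate on second coordinates; it lets
    -- `cartesianProduct-All` carry `r` over to the pairs.
    (All.map⁺ (All.universal (λ y → All.map (λ p → inj₂ (proj₁ p)) (cartesianProduct-All r (All.universal (λ _ → ≡.refl {x = 0}) ys))) ys))

  AllPairs-refine : ∀ {P : A → Set} {R S : A → A → Set} → (∀ {x y} → P x → P y → R x y → S x y) →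
    ∀ {xs} → All P xs → AllPairs R xs → AllPairs S xs
  AllPairs-refine f []       []       = []
  AllPairs-refine f (p ∷ ps) (r ∷ rs) = All.zipWith (λ (q , s) → f p q s) (ps , r) ∷ AllPairs-refine f ps rs

  lookup-injective : ∀ {S : A → A → Set} → (∀ {x y} → S x y → S y x) → ∀ {xs} →
    AllPairs (λ x y → ¬ S x y) xs → ∀ i j → S (lookup xs i) (lookup xs j) → i ≡ j
  lookup-injective S-sym (_ ∷ _)  Fin.zero    Fin.zero    s = ≡.refl
  lookup-injective S-sym (n ∷ _)  Fin.zero    (Fin.suc j) s = ⊥-elim (All.lookup n (∈-lookup j) s)
  lookup-injective S-sym (n ∷ _)  (Fin.suc i) Fin.zero    s = ⊥-elim (All.lookup n (∈-lookup i) (S-sym s))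
  lookup-injective S-sym (_ ∷ ns) (Fin.suc i) (Fin.suc j) s = ≡.cong Fin.suc (lookup-injective S-sym ns i j s)

module _ (R : RealNumbers) where
  open OrderedField R

  -- Sending t to the positions of p t and q t in L is injective, since equal positions force equal
  -- values.
  pairs-bound : ∀ {T : Set} (p q : T → Carrier) {ts : List T} {L : List Carrier} →
    AllPairs (λ s t → ¬ (p s ≈ p t × q s ≈ q t)) ts →
    All (λ t → Any (p t ≈_) L × Any (q t ≈_) L) ts →
    length ts ℕ.≤ length L ℕ.* length L
  pairs-bound p q {ts} {L} distinct members = Fin.injective⇒≤ {f = code} code-injective
    where
    place : ∀ i → Any (p (lookup ts i) ≈_) L × Any (q (lookup ts i) ≈_) L
    place i = All.lookup members (∈-lookup i)

    code : Fin (length ts) → Fin (length L ℕ.* length L)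
    code i = Fin.combine (Any.index (proj₁ (place i))) (Any.index (proj₂ (place i)))

    same : ∀ {x y} (m : Any (x ≈_) L) (n : Any (y ≈_) L) → Any.index m ≡ Any.index n → x ≈ y
    same m n e = trans (Any.lookup-index m)
      (trans (reflexive (≡.cong (lookup L) e)) (sym (Any.lookup-index n)))

    code-injective : ∀ {i j} → code i ≡ code j → i ≡ j
    code-injective {i} {j} e with Fin.combine-injective _ _ _ _ e
    ... | e₁ , e₂ = lookup-injective (λ (a , b) → sym a , sym b) distinct i j
      (same (proj₁ (place i)) (proj₁ (place j)) e₁ , same (proj₂ (place i)) (proj₂ (place j)) e₂)

-- Ratios as quotients of equally long products

nums≤ : ∀ k → All (ℕ._≤ k) (nums k)
dens≤ : ∀ k → All (ℕ._≤ k) (dens k)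
nums≤ ℕ.zero  = []
nums≤ (suc k) = All.++⁺ (All.map ℕ.m≤n⇒m≤1+n (nums≤ k)) (All.map⁺ (All.map ℕ.s≤s (dens≤ k)))
dens≤ ℕ.zero  = ℕ.z≤n ∷ []
dens≤ (suc k) = All.++⁺ (All.map ℕ.m≤n⇒m≤1+n (dens≤ k)) (All.map⁺ (All.map ℕ.s≤s (nums≤ k)))

totalLength : (ℕ → List ℕ) → ℕ → ℕ → ℕ
totalLength f k ℕ.zero  = 0
totalLength f k (suc r) = length (f k) ℕ.+ totalLength f (suc k) r

totalLength-nums≡dens : ∀ k r → totalLength nums (suc k) r ≡ totalLength dens (suc k) r
totalLength-nums≡dens k ℕ.zero  = ≡.refl
totalLength-nums≡dens k (suc r) = ≡.cong₂ ℕ._+_ (length-nums≡dens k) (totalLength-nums≡dens (suc k) r)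

module Factors (R : RealNumbers) where
  open OrderedField R
  open Evaluation R
  open Squeezing R
  open SetoidReasoning setoid

  prod : List Carrier → Carrier
  prod []      = 1#
  prod (x ∷ l) = x · prod l

  shifts : List ℕ → Carrier → List Carrier
  shifts js y = map (λ j → y + ι (+ j)) js

  factors : (ℕ → List ℕ) → ℕ → List Carrier → List Carrier
  factors f k []      = []
  factors f k (y ∷ τ) = shifts (f k) y ++ factors f (suc k) τ

  prod-++ : ∀ l l′ → prod (l ++ l′) ≈ prod l · prod l′
  prod-++ []      l′ = sym (*-identityˡ _)
  prod-++ (x ∷ l) l′ = trans (*-congˡ (prod-++ l l′)) (sym (*-assoc _ _ _))

  prod-shifts : ∀ js y → prod (shifts js y) ≈ shiftProd js y
  prod-shifts []       y = refl
  prod-shifts (j ∷ js) y = *-congˡ (prod-shifts js y)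

  prod-factors : ∀ f k y τ → prod (factors f k (y ∷ τ)) ≈ shiftProd (f k) y · prod (factors f (suc k) τ)
  prod-factors f k y τ = trans (prod-++ (shifts (f k) y) _) (*-congʳ (prod-shifts (f k) y))

  factors-Pos : ∀ f k {τ} → All Pos τ → Pos (prod (factors f k τ))
  factors-Pos f k []       = 0<1
  factors-Pos f k {y ∷ τ} (p ∷ ps) = Pos-resp (sym (prod-factors f k y τ))
    (Pos-· (shiftProd-Pos (f k) p) (factors-Pos f (suc k) ps))

  value-factors : ∀ k {τ} → All Pos τ → prod (factors nums k τ) ≈ value k τ · prod (factors dens k τ)
  value-factors k []                 = sym (*-identityˡ 1#)
  value-factors k {y ∷ τ} (p ∷ ps)   = begin
    prod (factors nums k (y ∷ τ))                                  ≈⟨ prod-factors nums k y τ ⟩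
    shiftProd (nums k) y · prod (factors nums (suc k) τ)           ≈⟨ *-cong (sym (ratio-· k p)) (value-factors (suc k) ps) ⟩
    ratio k y · D · (V · Q)                                        ≈⟨ solve 4 (λ r D V Q → r :* D :* (V :* Q) := r :* V :* (D :* Q)) refl (ratio k y) D V Q ⟩
    ratio k y · V · (D · Q)                                        ≈⟨ *-congˡ (sym (prod-factors dens k y τ)) ⟩
    value k (y ∷ τ) · prod (factors dens k (y ∷ τ))                ∎
    where
    D V Q : Carrier
    D = shiftProd (dens k) y
    V = value (suc k) τ
    Q = prod (factors dens (suc k) τ)

  length-factors : ∀ f k τ → length (factors f k τ) ≡ totalLength f k (length τ)
  length-factors f k []      = ≡.refl
  length-factors f k (y ∷ τ) = ≡.trans (length-++ (shifts (f k) y))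
    (≡.cong₂ ℕ._+_ (length-map _ (f k)) (length-factors f (suc k) τ))

  -- The length condition says that the last level is h; as level k shifts by at most k, the window
  -- 0, ..., h contains every shift that occurs.
  factors-All : ∀ {P : Carrier → Set} f (f≤ : ∀ k → All (ℕ._≤ k) (f k)) h k τ → k ℕ.+ length τ ≡ suc h →
    All (λ y → ∀ j → j ℕ.≤ h → P (y + ι (+ j))) τ → All P (factors f k τ)
  factors-All f f≤ h k []      e []       = []
  factors-All f f≤ h k (y ∷ τ) e (p ∷ ps) = All.++⁺
    (All.map⁺ (All.map (λ {j} j≤k → p j (ℕ.≤-trans j≤k k≤h)) (f≤ k)))
    (factors-All f f≤ h (suc k) τ (≡.trans (≡.sym (ℕ.+-suc k (length τ))) e) ps)
    where
    k≤h : k ℕ.≤ h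
    k≤h = ℕ.≤-trans (ℕ.m≤m+n k (length τ)) (ℕ.≤-reflexive (ℕ.suc-injective (≡.trans (≡.sym (ℕ.+-suc k (length τ))) e)))

  prod-scaled : ∀ δ l → prod (map (δ ·_) l) ≈ δ ^ length l · prod l
  prod-scaled δ []      = sym (*-identityˡ 1#)
  prod-scaled δ (x ∷ l) = trans (*-congˡ (prod-scaled δ l))
    (solve 4 (λ δ x p q → (δ :* x) :* (p :* q) := (δ :* p) :* (x :* q)) refl δ x (δ ^ length l) (prod l))

  prod-InProdSet : ∀ {X : Carrier → Set} l → All X l → InProdSet R (length l) X (prod l)
  prod-InProdSet []      []       = (λ ()) , (λ ()) , refl
  prod-InProdSet {X} (x ∷ l) (p ∷ ps) with prod-InProdSet l ps
  ... | xs , ps′ , e = xs⁺ , ps⁺ , *-congˡ e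
    where
    xs⁺ : Fin (suc (length l)) → Carrier
    xs⁺ Fin.zero    = x
    xs⁺ (Fin.suc i) = xs i
    ps⁺ : ∀ i → X (xs⁺ i)
    ps⁺ Fin.zero    = p
    ps⁺ (Fin.suc i) = ps′ i

-- The exponent m. The levels 1, ..., h contribute 2^h - 1 factors on each side; the other two are x
-- with δ above the bar, and x with the denominator of level 0 below. In total m = 2^h + 1.
factorCount : ℕ → ℕ
factorCount h = 2 ℕ.+ totalLength nums 1 h

module RatioPairs (R : RealNumbers) (X : RealNumbers.Carrier R → Set) where
  open OrderedField R
  open Squeezing R
  open SpreadLists R
  open Factors R
  open SetoidReasoning setoid

  module _ (h : ℕ) {δ : Carrier} (δ>0 : Pos δ) (Y : List Carrier)
    (window : All (λ y → Pos y × (∀ j → j ℕ.≤ h → X (δ · (y + ι (+ j))))) Y)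
    (X-y : All (λ y → X (δ · y)) Y) (X-1 : X (δ · 1#)) where

    private
      Item : Set
      Item = List Carrier × Carrier

      items : List Item
      items = cartesianProduct (tuples (suc h) Y) Y

      -- Level 0 has a denominator but no numerator. The entry `1#`, which becomes δ after dilation,
      -- balances the two counts, so that the same power of δ cancels everywhere.
      upperFactors lowerFactors : Item → List Carrier
      upperFactors (τ , x) = 1# ∷ x ∷ factors nums 0 τ
      lowerFactors (τ , x) = x ∷ factors dens 0 τ

      product : (Item → List Carrier) → Item → Carrier
      product f s = prod (map (δ ·_) (f s))

      Good : Item → Set
      Good (τ , x) = (All (λ y → Pos y × (∀ j → j ℕ.≤ h → X (δ · (y + ι (+ j))))) τ × length τ ≡ suc h) × (Pos x × X (δ · x))

      good : All Good items
      good = cartesianProduct-All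
        (All.zip (tuples-All (suc h) window , tuples-length (suc h) Y))
        (All.zip (All.map proj₁ window , X-y))

      length-upper : ∀ {s} → Good s → length (upperFactors s) ≡ factorCount h
      length-upper {τ , x} ((_ , e) , _) = ≡.cong (λ n → suc (suc n))
        (≡.trans (length-factors nums 0 τ) (≡.cong (totalLength nums 0) e))

      length-lower : ∀ {s} → Good s → length (lowerFactors s) ≡ factorCount h
      length-lower {τ , x} ((_ , e) , _) = ≡.cong suc
        (≡.trans (length-factors dens 0 τ) (≡.trans (≡.cong (totalLength dens 0) e)
          (≡.cong suc (≡.sym (totalLength-nums≡dens 0 h)))))

      unscale : ∀ {l l′} → length l ≡ factorCount h → length l′ ≡ factorCount h →
        prod (map (δ ·_) l) ≈ prod (map (δ ·_) l′) → prod l ≈ prod l′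
      unscale {l} {l′} e e′ eq = ·-cancelʳ (Pos⇒≉0 (^-Pos (factorCount h) δ>0)) (begin
        prod l · δ ^ factorCount h      ≈⟨ *-comm _ _ ⟩
        δ ^ factorCount h · prod l      ≡⟨ ≡.cong (λ n → δ ^ n · prod l) (≡.sym e) ⟩
        δ ^ length l · prod l           ≈⟨ sym (prod-scaled δ l) ⟩
        prod (map (δ ·_) l)             ≈⟨ eq ⟩
        prod (map (δ ·_) l′)            ≈⟨ prod-scaled δ l′ ⟩
        δ ^ length l′ · prod l′         ≡⟨ ≡.cong (λ n → δ ^ n · prod l′) e′ ⟩
        δ ^ factorCount h · prod l′     ≈⟨ *-comm _ _ ⟩
        prod l′ · δ ^ factorCount h     ∎)

      -- The quotient of the two products is `value 0 τ`, independent of x, so equal pairs have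
      -- equal values; this excludes different tuples. For the same tuple, cancelling its
      -- denominator from the lower products recovers x.
      separated : ∀ {s t} → Good s → Good t →
        (proj₁ s ≡ proj₁ t × ¬ (proj₂ s ≈ proj₂ t)) ⊎ value 0 (proj₁ t) < value 0 (proj₁ s) →
        ¬ (product upperFactors s ≈ product upperFactors t × product lowerFactors s ≈ product lowerFactors t)
      separated {τ , x} {τ′ , x′} gs gt apart (eu , el) = absurd apart
        where
        τ>0 : All Pos τ
        τ>0 = All.map proj₁ (proj₁ (proj₁ gs))
        τ′>0 : All Pos τ′
        τ′>0 = All.map proj₁ (proj₁ (proj₁ gt))
        d d′ : Carrier
        d  = prod (factors dens 0 τ)
        d′ = prod (factors dens 0 τ′)
        lower-eq : x · d ≈ x′ · d′
        lower-eq = unscale {lowerFactors (τ , x)} {lowerFactors (τ′ , x′)} (length-lower gs) (length-lower gt) el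
        upper-eq : 1# · (x · prod (factors nums 0 τ)) ≈ 1# · (x′ · prod (factors nums 0 τ′))
        upper-eq = unscale {upperFactors (τ , x)} {upperFactors (τ′ , x′)} (length-upper gs) (length-upper gt) eu
        values-eq : value 0 τ ≈ value 0 τ′
        values-eq = ·-cancelʳ (Pos⇒≉0 (Pos-· (proj₁ (proj₂ gs)) (factors-Pos dens 0 τ>0))) (begin
          value 0 τ · (x · d)                      ≈⟨ solve 3 (λ v x d → v :* (x :* d) := x :* (v :* d)) refl (value 0 τ) x d ⟩
          x · (value 0 τ · d)                      ≈⟨ *-congˡ (sym (value-factors 0 τ>0)) ⟩
          x · prod (factors nums 0 τ)              ≈⟨ sym (*-identityˡ _) ⟩
          1# · (x · prod (factors nums 0 τ))       ≈⟨ upper-eq ⟩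
          1# · (x′ · prod (factors nums 0 τ′))     ≈⟨ *-identityˡ _ ⟩
          x′ · prod (factors nums 0 τ′)            ≈⟨ *-congˡ (value-factors 0 τ′>0) ⟩
          x′ · (value 0 τ′ · d′)                   ≈⟨ solve 3 (λ v x d → x :* (v :* d) := v :* (x :* d)) refl (value 0 τ′) x′ d′ ⟩
          value 0 τ′ · (x′ · d′)                   ≈⟨ *-congˡ (sym lower-eq) ⟩
          value 0 τ′ · (x · d)                     ∎)
        absurd : ¬ ((τ ≡ τ′ × ¬ (x ≈ x′)) ⊎ value 0 τ′ < value 0 τ)
        absurd (inj₂ l)              = <-irrefl (sym values-eq) l
        absurd (inj₁ (≡.refl , x≉x′)) = x≉x′ (·-cancelʳ (Pos⇒≉0 (factors-Pos dens 0 τ>0)) lower-eq)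

      upper-InProdSet : ∀ {s} → Good s → InProdSet R (factorCount h) X (product upperFactors s)
      upper-InProdSet {s@(τ , x)} g@((w , e) , (_ , X-x)) = ≡.subst (λ n → InProdSet R n X (product upperFactors s))
        (≡.trans (length-map (δ ·_) (upperFactors s)) (length-upper g))
        (prod-InProdSet {X} (map (δ ·_) (upperFactors s))
          (X-1 ∷ X-x ∷ All.map⁺ (factors-All nums nums≤ h 0 τ e (All.map proj₂ w))))

      lower-InProdSet : ∀ {s} → Good s → InProdSet R (factorCount h) X (product lowerFactors s)
      lower-InProdSet {s@(τ , x)} g@((w , e) , (_ , X-x)) = ≡.subst (λ n → InProdSet R n X (product lowerFactors s))
        (≡.trans (length-map (δ ·_) (lowerFactors s)) (length-lower g))
        (prod-InProdSet {X} (map (δ ·_) (lowerFactors s))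
          (X-x ∷ All.map⁺ (factors-All dens dens≤ h 0 τ e (All.map proj₂ w))))

      decSetoid : DecSetoid _ _
      decSetoid = record { isDecEquivalence = record { isEquivalence = isEquivalence ; _≟_ = _≟_ } }

    -- Multiplying numerator and denominator by a further x ∈ Y costs no ratio but gains a factor |Y|.
    many-products : Decreasing 0 (tuples (suc h) Y) → Distinct R Y →
      Σ (List Carrier) λ L → Distinct R L × All (InProdSet R (factorCount h) X) L ×
        length (tuples (suc h) Y) ℕ.* length Y ℕ.≤ length L ℕ.* length L
    many-products dec distinct = L , Unique.deduplicate-! decSetoid all ,
      All.deduplicate⁺ _≟_ (All.++⁺ (All.map⁺ (All.map (λ {s} → upper-InProdSet {s}) good)) (All.map⁺ (All.map (λ {s} → lower-InProdSet {s}) good))) ,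
      ≡.subst (ℕ._≤ length L ℕ.* length L) (length-cartesianProduct (tuples (suc h) Y) Y)
        (pairs-bound R (product upperFactors) (product lowerFactors)
          (AllPairs-refine (λ {s} {t} → separated {s} {t}) good (cartesianProduct-AllPairs dec distinct))
          (All.tabulate members))
      where
      all L : List Carrier
      all = map (product upperFactors) items ++ map (product lowerFactors) items
      L   = deduplicate _≟_ all

      keep : ∀ {z} → z ∈ all → Any (z ≈_) L
      keep m = Any.deduplicate⁺ _≟_ (λ y≈x z≈x → trans z≈x (sym y≈x)) (Any.map reflexive m)

      members : ∀ {s} → s ∈ items → Any (product upperFactors s ≈_) L × Any (product lowerFactors s ≈_) L
      members m = keep (Any.++⁺ˡ (∈-map⁺ (product upperFactors) m)) ,
        keep (Any.++⁺ʳ (map (product upperFactors) items) (∈-map⁺ (product lowerFactors) m))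

-- Products of elements of sA - sA

module SumDifferences (R : RealNumbers) (A : List (RealNumbers.Carrier R)) where
  open OrderedField R
  open SetoidReasoning setoid

  InA : Carrier → Set
  InA x = _∈ᴸ_ R x A

  InSumDiff-resp : ∀ s {z z′} → z ≈ z′ → InSumDiff R s A z → InSumDiff R s A z′
  InSumDiff-resp s e (xs , ys , p , q , eq) = xs , ys , p , q , trans (sym e) eq

  InSumDiff-suc : ∀ {s z z′ p q} → InSumDiff R s A z → InA p → InA q → z′ ≈ z + (p - q) →
    InSumDiff R (suc s) A z′
  InSumDiff-suc {p = p} {q} (xs , ys , xs∈ , ys∈ , eq) p∈ q∈ e =
    p ∷ᶠ xs , q ∷ᶠ ys , p∈ ∷ᶠ′ xs∈ , q∈ ∷ᶠ′ ys∈ ,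
    trans e (trans (+-congʳ eq) (solve 4 (λ x y p q → (x :- y) :+ (p :- q) := (p :+ x) :- (q :+ y)) refl
      (sumF R xs) (sumF R ys) p q))
    where
    _∷ᶠ_ : ∀ {n} → Carrier → (Fin n → Carrier) → Fin (suc n) → Carrier
    (x ∷ᶠ f) Fin.zero    = x
    (x ∷ᶠ f) (Fin.suc i) = f i
    _∷ᶠ′_ : ∀ {n x} {f : Fin n → Carrier} → InA x → (∀ i → InA (f i)) → ∀ i → InA ((x ∷ᶠ f) i)
    (m ∷ᶠ′ g) Fin.zero    = m
    (m ∷ᶠ′ g) (Fin.suc i) = g i

  InSumDiff-zero : ∀ s {p} → InA p → InSumDiff R s A 0#
  InSumDiff-zero s {p} m = (λ _ → p) , (λ _ → p) , (λ _ → m) , (λ _ → m) , sym (-‿inverseʳ _)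

  InSumDiff-difference : ∀ s {b b′} → InA b → InA b′ → InSumDiff R (suc s) A (b′ - b)
  InSumDiff-difference s b∈ b′∈ = InSumDiff-suc (InSumDiff-zero s b∈) b′∈ b∈ (sym (+-identityˡ _))

  module _ {p q b b′ : Carrier} (p∈ : InA p) (q∈ : InA q) (b∈ : InA b) (b′∈ : InA b′) where

    -- Each further summand moves the window -t, …, t of multiples of b′ - b by -1, 0 or 1.
    InSumDiff-window : ∀ t j → j ℕ.≤ t ℕ.+ t →
      InSumDiff R (suc t) A ((p - q) + (ι (+ j) - ι (+ t)) · (b′ - b))
    InSumDiff-window ℕ.zero ℕ.zero _ = InSumDiff-suc (InSumDiff-zero 0 b∈) p∈ q∈
      (solve 3 (λ p q δ → (p :- q) :+ (con (+ 0) :- con (+ 0)) :* δ := con (+ 0) :+ (p :- q)) refl p q (b′ - b))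
    InSumDiff-window (suc t) ℕ.zero _ = InSumDiff-suc (InSumDiff-window t 0 ℕ.z≤n) b∈ b′∈
      (trans (+-congˡ (*-congʳ (+-congˡ (-‿cong (ι-+ (+ 1) (+ t))))))
        (solve 4 (λ d t b b′ → d :+ (con (+ 0) :- (con (+ 1) :+ t)) :* (b′ :- b) := d :+ (con (+ 0) :- t) :* (b′ :- b) :+ (b :- b′))
          refl (p - q) (ι (+ t)) b b′))
    InSumDiff-window (suc t) (suc ℕ.zero) _ = InSumDiff-suc (InSumDiff-window t 0 ℕ.z≤n) b∈ b∈
      (trans (+-congˡ (*-congʳ (+-congˡ (-‿cong (ι-+ (+ 1) (+ t))))))
        (solve 4 (λ d t b b′ → d :+ (con (+ 1) :- (con (+ 1) :+ t)) :* (b′ :- b) := d :+ (con (+ 0) :- t) :* (b′ :- b) :+ (b :- b))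
          refl (p - q) (ι (+ t)) b b′))
    InSumDiff-window (suc t) (suc (suc j)) le = InSumDiff-suc (InSumDiff-window t j j≤) b′∈ b∈
      (trans (+-congˡ (*-congʳ (+-cong (ι-+ (+ 2) (+ j)) (-‿cong (ι-+ (+ 1) (+ t))))))
        (solve 5 (λ d t j b b′ → d :+ ((con (+ 2) :+ j) :- (con (+ 1) :+ t)) :* (b′ :- b) := d :+ (j :- t) :* (b′ :- b) :+ (b′ :- b))
          refl (p - q) (ι (+ t)) (ι (+ j)) b b′))
      where
      j≤ : j ℕ.≤ t ℕ.+ t
      j≤ = ℕ.s≤s⁻¹ (ℕ.s≤s⁻¹ (≡.subst (suc (suc j) ℕ.≤_) (≡.cong suc (ℕ.+-suc t t)) le))

-- The smallest gap and thinning

module Gaps (R : RealNumbers) where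
  open OrderedField R

  private
    strictTotalOrder : StrictTotalOrder _ _ _
    strictTotalOrder = record { isStrictTotalOrder = isStrictTotalOrder }

    decTotalOrder : DecTotalOrder _ _ _
    decTotalOrder = StrictTotalOrderProperties.decTotalOrder strictTotalOrder

    open Sort decTotalOrder using (sort; sort-↭; sort-↗)

  increasing-permutation : ∀ A → Distinct R A → Σ (List Carrier) λ S → S ↭ A × AllPairs _<_ S
  increasing-permutation A distinct = sort A , sort-↭ A , AllPairs.zipWith strict
    (Linked.Linked⇒AllPairs (DecTotalOrder.trans decTotalOrder) (sort-↗ A) ,
     Permutation.AllPairs-resp-↭ (≡.setoid Carrier) (λ ne e → ne (sym e))
       ((λ { ≡.refl ne → ne }) , (λ { ≡.refl ne → ne })) (↭⇒↭ₛ (↭-sym (sort-↭ A))) distinct)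
    where
    strict : ∀ {x y} → (x < y ⊎ x ≈ y) × ¬ (x ≈ y) → x < y
    strict (inj₁ l , _)  = l
    strict (inj₂ e , ne) = ⊥-elim (ne e)

  -- In an increasing list only neighbours compete: the first gap is compared with the smallest gap
  -- of the rest, and every gap that starts at x contains the one to y.
  minimal-gap : ∀ x y l → AllPairs _<_ (x ∷ y ∷ l) →
    Σ Carrier λ b → Σ Carrier λ b′ → b ∈ x ∷ y ∷ l × b′ ∈ x ∷ y ∷ l × b < b′ ×
      AllPairs (λ p q → p + (b′ - b) ≼ q) (x ∷ y ∷ l)
  minimal-gap x y [] ((x<y ∷ []) ∷ _) = x , y , here ≡.refl , there (here ≡.refl) , x<y ,
    (≈⇒≼ (solve 2 (λ x y → x :+ (y :- x) := y) refl x y) ∷ []) ∷ [] ∷ []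
  minimal-gap x y (z ∷ l) ((x<y ∷ _) ∷ rest@(y<l ∷ _)) with minimal-gap y z l rest
  ... | b , b′ , b∈ , b′∈ , b<b′ , gaps with ≼⊎> (b′ - b) (y - x)
  ...   | inj₁ δ≤ = b , b′ , there b∈ , there b′∈ , b<b′ , (first ∷ All.map (λ y<w → ≼-trans first (<⇒≼ y<w)) y<l) ∷ gaps
    where
    first : x + (b′ - b) ≼ y
    first = ≼-by (≼-diff δ≤) (solve 4 (λ x y b b′ → y :- x :- (b′ :- b) := y :- (x :+ (b′ :- b))) refl x y b b′)
  ...   | inj₂ <δ = x , y , here ≡.refl , there (here ≡.refl) , x<y ,
    (first ∷ All.map (λ y<w → ≼-trans first (<⇒≼ y<w)) y<l) ∷
      AllPairs.map (λ p → ≼-trans (+-mono-≼ ≼-refl (<⇒≼ <δ)) p) gaps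
    where
    first : x + (y - x) ≼ y
    first = ≈⇒≼ (solve 2 (λ x y → x :+ (y :- x) := y) refl x y)

  -- Keeps one entry, after skipping c, out of every g + 1.
  sparse : ∀ {A : Set} → ℕ → ℕ → List A → List A
  sparse g c         []      = []
  sparse g ℕ.zero    (x ∷ l) = x ∷ sparse g g l
  sparse g (suc c)   (x ∷ l) = sparse g c l

  sparse-All : ∀ {A : Set} {P : A → Set} g c {l} → All P l → All P (sparse g c l)
  sparse-All g c       []       = []
  sparse-All g ℕ.zero  (p ∷ ps) = p ∷ sparse-All g g ps
  sparse-All g (suc c) (p ∷ ps) = sparse-All g c ps

  sparse-length : ∀ {A : Set} g c (l : List A) → length l ℕ.≤ c ℕ.+ suc g ℕ.* length (sparse g c l)
  sparse-length g c       []      = ℕ.z≤n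
  sparse-length g ℕ.zero  (x ∷ l) = ≡.subst (suc (length l) ℕ.≤_) (≡.sym (ℕ.*-suc (suc g) (length (sparse g g l)))) (ℕ.s≤s (sparse-length g g l))
  sparse-length g (suc c) (x ∷ l) = ℕ.s≤s (sparse-length g c l)

  module _ {δ : Carrier} where

    -- Each skipped entry advances p by one more δ. In `sparse-gaps` the point p is the entry kept
    -- last.
    sparse-far : ∀ g c {p l} → All (p + δ ≼_) l → AllPairs (λ x y → x + δ ≼ y) l →
      All (p + ι (+ suc c) · δ ≼_) (sparse g c l)
    sparse-far g c       []       _        = []
    sparse-far g ℕ.zero  {p} fs@(_ ∷ _) _  = All.map (≼-trans (≈⇒≼ (+-congˡ (trans (*-congʳ ι-1) (*-identityˡ δ))))) (sparse-All g 0 fs)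
    sparse-far g (suc c) {p} {x ∷ l} (f ∷ _) (g′ ∷ gs) = All.map (λ q → ≼-trans (≼-by (≼-diff f)
      (trans (solve 4 (λ p x δ n → x :- (p :+ δ) := x :+ n :* δ :- (p :+ (con (+ 1) :+ n) :* δ)) refl p x δ (ι (+ suc c)))
        (+-congˡ (-‿cong (+-congˡ (*-congʳ (sym (ι-+ (+ 1) (+ suc c))))))))) q) (sparse-far g c g′ gs)

    sparse-gaps : ∀ g c {l} → AllPairs (λ x y → x + δ ≼ y) l →
      AllPairs (λ x y → x + ι (+ suc g) · δ ≼ y) (sparse g c l)
    sparse-gaps g c       []       = []
    sparse-gaps g ℕ.zero  (q ∷ qs) = sparse-far g g q qs ∷ sparse-gaps g g qs
    sparse-gaps g (suc c) (q ∷ qs) = sparse-gaps g c qs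

-- Normalising A and combining the estimates

open import Data.Nat using (_*_; _^_; _≤_)

square-cancel-≤ : ∀ {m n} → m * m ≤ n * n → m ≤ n
square-cancel-≤ {m} {n} le with ℕ.≤-total m n
... | inj₁ m≤n = m≤n
... | inj₂ n≤m with ℕ.m≤n⇒m<n∨m≡n n≤m
...   | inj₁ n<m = ⊥-elim (ℕ.<⇒≱ (ℕ.*-mono-< n<m n<m) le)
...   | inj₂ ≡.refl = ℕ.≤-refl

*-^ : ∀ m n r → (m * n) ^ r ≡ m ^ r * n ^ r
*-^ m n ℕ.zero  = ≡.refl
*-^ m n (suc r) = ≡.trans (≡.cong (m * n *_) (*-^ m n r))
  (solve 4 (λ m n p q → m :* n :* (p :* q) := m :* p :* (n :* q)) ≡.refl m n (m ^ r) (n ^ r))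
  where open ℕSolver.+-*-Solver

-- With N = r + 1 points and s = t + 1, squaring gives n^(2s) ≤ M^(2s)·N^(2t+1)·N ≤ M^(2s)·f·L².
-- Enlarging f to f² makes the right side a square, so the root stays within the natural numbers.
power-bound : ∀ t f n r M T L → n ≤ M * suc r → f ≡ suc (t ℕ.+ t) ! →
  suc r ^ suc (t ℕ.+ t) ≤ f * T → T * suc r ≤ L * L →
  n ^ suc t ≤ M ^ suc t * f * L
power-bound t f n r M T L n≤ f≡ count pairs = square-cancel-≤ (begin
  n ^ s * n ^ s                              ≤⟨ ℕ.*-mono-≤ (ℕ.^-monoˡ-≤ s n≤) (ℕ.^-monoˡ-≤ s n≤) ⟩
  (M * suc r) ^ s * (M * suc r) ^ s          ≡⟨ ≡.cong₂ _*_ (*-^ M (suc r) s) (*-^ M (suc r) s) ⟩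
  M ^ s * suc r ^ s * (M ^ s * suc r ^ s)    ≡⟨ solve 2 (λ a b → a :* b :* (a :* b) := a :* a :* (b :* b)) ≡.refl (M ^ s) (suc r ^ s) ⟩
  M ^ s * M ^ s * (suc r ^ s * suc r ^ s)    ≡⟨ ≡.cong (M ^ s * M ^ s *_) exponents ⟩
  M ^ s * M ^ s * (suc r ^ suc (t ℕ.+ t) * suc r)  ≤⟨ ℕ.*-monoʳ-≤ (M ^ s * M ^ s) (ℕ.*-monoˡ-≤ (suc r) count) ⟩
  M ^ s * M ^ s * (f * T * suc r)            ≡⟨ ≡.cong (M ^ s * M ^ s *_) (ℕ.*-assoc f T (suc r)) ⟩
  M ^ s * M ^ s * (f * (T * suc r))          ≤⟨ ℕ.*-monoʳ-≤ (M ^ s * M ^ s) (ℕ.*-monoʳ-≤ f pairs) ⟩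
  M ^ s * M ^ s * (f * (L * L))              ≤⟨ ℕ.*-monoʳ-≤ (M ^ s * M ^ s) (ℕ.*-monoˡ-≤ (L * L) f≤f²) ⟩
  M ^ s * M ^ s * (f * f * (L * L))          ≡⟨ solve 3 (λ a f l → a :* a :* (f :* f :* (l :* l)) := a :* f :* l :* (a :* f :* l)) ≡.refl (M ^ s) f L ⟩
  M ^ s * f * L * (M ^ s * f * L)            ∎)
  where
  open ℕ.≤-Reasoning
  open ℕSolver.+-*-Solver
  s : ℕ
  s = suc t
  exponents : suc r ^ s * suc r ^ s ≡ suc r ^ suc (t ℕ.+ t) * suc r
  exponents = ≡.trans (solve 2 (λ x a → (x :* a) :* (x :* a) := (x :* (a :* a)) :* x) ≡.refl (suc r) (suc r ^ t))
    (≡.cong (λ z → suc r * z * suc r) (≡.sym (ℕ.^-distribˡ-+-* (suc r) t t)))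
  f≤f² : f ≤ f * f
  f≤f² = ≡.subst (λ z → z ≤ z * z) (≡.sym f≡) (ℕ.m≤m*n (suc (t ℕ.+ t) !) (suc (t ℕ.+ t) !) {{ℕ.>-nonZero (ℕ.1≤n! (suc (t ℕ.+ t)))}})

module Normalisation (R : RealNumbers) {δ : RealNumbers.Carrier R} (δ>0 : OrderedField.Pos R δ)
  (x₀ θ : RealNumbers.Carrier R) where
  open OrderedField R

  normalise : Carrier → Carrier
  normalise z = (z - x₀) · δ ⁻¹ - θ

  scaled-gap : ∀ {n w z} → w + n · δ ≼ z → n ≼ (z - w) · δ ⁻¹
  scaled-gap {n} {w} {z} le = ≼-by (Nonneg-· (≼-diff le) (inj₁ (⁻¹-Pos δ>0)))
    (trans (solve 5 (λ w z n δ e → (z :- (w :+ n :* δ)) :* e := (z :- w) :* e :- n :* (δ :* e)) refl w z n δ (δ ⁻¹))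
      (+-congˡ (-‿cong (trans (*-congˡ (⁻¹-inverse-Pos δ>0)) (*-identityʳ _)))))

  normalise-far : ∀ {n z} → x₀ + n · δ ≼ z → n - θ ≼ normalise z
  normalise-far le = +-mono-≼ (scaled-gap le) ≼-refl

  normalise-gap : ∀ {n w z} → w + n · δ ≼ z → normalise w + n ≼ normalise z
  normalise-gap {n} {w} {z} le = ≼-by (≼-diff (scaled-gap le))
    (solve 6 (λ x w z e θ n → (z :- w) :* e :- n := ((z :- x) :* e :- θ) :- ((w :- x) :* e :- θ :+ n)) refl x₀ w z (δ ⁻¹) θ n)

  unnormalise : ∀ z j → (z - x₀) + (j - θ) · δ ≈ δ · (normalise z + j)
  unnormalise z j = sym (trans
    (solve 5 (λ d e δ θ j → δ :* ((d :* e :- θ) :+ j) := d :* (δ :* e) :+ (j :- θ) :* δ) refl (z - x₀) (δ ⁻¹) δ θ j)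
    (+-congʳ (trans (*-congˡ (⁻¹-inverse-Pos δ>0)) (*-identityʳ _))))

module _ (t C : ℕ) where

  -- The summand t makes up for the subtraction of t in the normalisation.
  spacing : ℕ
  spacing = suc C ℕ.+ suc C ℕ.+ t

  -- Thinning gives length A ≤ (spacing + 1)(1 + length Z), which is at most twice (spacing +
  -- 1)·length Z once Z is nonempty. An empty Z leaves at most spacing + 1 elements, also within
  -- this bound.
  elementBound : ℕ
  elementBound = suc spacing ℕ.+ suc spacing

  constant : ℕ
  constant = elementBound ^ suc t * suc (t ℕ.+ t) !

  power≤constant : elementBound ^ suc t ≤ suc constant
  power≤constant = ℕ.m≤n⇒m≤1+n (ℕ.m≤m*n (elementBound ^ suc t) (suc (t ℕ.+ t) !)
    {{ℕ.>-nonZero (ℕ.1≤n! (suc (t ℕ.+ t)))}})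

  module _ (R : RealNumbers) (A : List (RealNumbers.Carrier R)) where
    open OrderedField R hiding (_^_)
    open SpreadLists R
    open RatioPairs R
    open Gaps R
    open SumDifferences R A

    Conclusion : Set
    Conclusion = Σ (List Carrier) λ L → Distinct R L ×
      All (InProdSet R (factorCount (t ℕ.+ t)) (InSumDiff R (suc t) A)) L ×
      length A ^ suc t ≤ suc constant * length L

    -- For a bounded number of elements one product is enough, the rest being absorbed by the
    -- constant; 0 = p - p lies in sA - sA.
    few-elements : ∀ {p} → InA p → length A ≤ elementBound → Conclusion
    few-elements p∈ small = z ∷ [] , [] ∷ [] ,
      ((λ _ → 0#) , (λ _ → InSumDiff-zero (suc t) p∈) , refl) ∷ [] ,
      ℕ.≤-trans (ℕ.^-monoˡ-≤ (suc t) small) (ℕ.≤-trans power≤constant (ℕ.≤-reflexive (≡.sym (ℕ.*-identityʳ (suc constant)))))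
      where
      z : Carrier
      z = prodF R {factorCount (t ℕ.+ t)} (λ _ → 0#)

    module Sparse (decreasing : ReciprocalSqueezed (t ℕ.+ t) C)
      {x₀ b b′ : Carrier} (x₀∈ : InA x₀) (b∈ : InA b) (b′∈ : InA b′) (δ>0 : Pos (b′ - b))
      {Z : List Carrier} (Z∈ : All InA Z)
      (far : All (x₀ + ι (+ suc spacing) · (b′ - b) ≼_) Z)
      (gaps : AllPairs (λ w z → w + ι (+ suc spacing) · (b′ - b) ≼ z) Z)
      (length-A : length A ≤ suc spacing ℕ.+ suc spacing * length Z) where
      open Normalisation R δ>0 x₀ (ι (+ t))

      private
        a : Carrier
        -- The successor secures a ≥ 1 in addition to a ≥ C.
        a = ι (+ suc C)

        spacing≈ : ι (+ suc spacing) ≈ ι (+ 1) + (a + a + ι (+ t))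
        spacing≈ = trans (ι-+ (+ 1) (+ spacing)) (+-congˡ
          (trans (ι-+ (+ (suc C ℕ.+ suc C)) (+ t)) (+-congʳ (ι-+ (+ suc C) (+ suc C)))))

        Y : List Carrier
        Y = map normalise Z

        2a≤spacing-t : a + a ≼ ι (+ suc spacing) - ι (+ t)
        2a≤spacing-t = ≼-by (ι-Nonneg 1) (trans
          (solve 3 (λ o a t → o := (o :+ (a :+ a :+ t)) :- t :- (a :+ a)) refl (ι (+ 1)) a (ι (+ t)))
          (+-congʳ (+-congʳ (sym spacing≈))))

        2a≤spacing : a + a ≼ ι (+ suc spacing)
        2a≤spacing = ≼-trans 2a≤spacing-t (≼-by (ι-Nonneg t)
          (solve 2 (λ n t → t := n :- (n :- t)) refl (ι (+ suc spacing)) (ι (+ t))))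

        spread : Spread a Y
        spread = All.map⁺ (All.map (λ le → ≼-trans 2a≤spacing-t (normalise-far le)) far) ,
          AllPairs.map⁺ (AllPairs.map (λ le → ≼-trans (+-mono-≼ ≼-refl 2a≤spacing) (normalise-gap le)) gaps)

        1≤a : 1# ≼ a
        1≤a = ≼-trans (≈⇒≼ (sym ι-1)) (ιℕ-mono {1} {suc C} (ℕ.s≤s ℕ.z≤n))

        distinct : Distinct R Y
        distinct = AllPairs.map (λ {y} p → <⇒≉ (<-≼-trans (<-by (Pos-+ (ι-Pos C) (ι-Nonneg (suc C)))
          (solve 2 (λ y a → a :+ a := (y :+ (a :+ a)) :- y) refl y a)) p)) (proj₂ spread)

        shifted∈ : ∀ {z} → InA z → ∀ j → j ≤ t ℕ.+ t → InSumDiff R (suc t) A ((b′ - b) · (normalise z + ι (+ j)))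
        shifted∈ {z} z∈ j j≤ = InSumDiff-resp (suc t) (unnormalise z (ι (+ j)))
          (InSumDiff-window z∈ x₀∈ b∈ b′∈ t j j≤)

        window : All (λ y → Pos y × (∀ j → j ≤ t ℕ.+ t → InSumDiff R (suc t) A ((b′ - b) · (y + ι (+ j))))) Y
        window = All.zip (All.map (far-Pos 1≤a) (proj₁ spread) , All.map⁺ (All.map shifted∈ Z∈))

        products : Σ (List Carrier) λ L → Distinct R L ×
          All (InProdSet R (factorCount (t ℕ.+ t)) (InSumDiff R (suc t) A)) L ×
          length (tuples (suc (t ℕ.+ t)) Y) * length Y ≤ length L * length L
        products = many-products (InSumDiff R (suc t) A) (t ℕ.+ t) δ>0 Y window
          (All.map (λ (_ , w) → InSumDiff-resp (suc t) (*-congˡ (+-identityʳ _)) (w 0 ℕ.z≤n)) window)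
          (InSumDiff-resp (suc t) (sym (*-identityʳ (b′ - b))) (InSumDiff-difference t b∈ b′∈))
          (decreasing R a 1≤a (ιℕ-mono {C} (ℕ.n≤1+n C)) Y spread) distinct

      conclude : ∀ r → length Z ≡ r → Conclusion
      conclude ℕ.zero e = few-elements b∈ (ℕ.≤-trans length-A
        (ℕ.+-monoʳ-≤ (suc spacing) (≡.subst (λ n → suc spacing * n ≤ suc spacing) (≡.sym e)
          (≡.subst (_≤ suc spacing) (≡.sym (ℕ.*-zeroʳ (suc spacing))) ℕ.z≤n))))
      conclude (suc r) e = L , proj₁ (proj₂ products) , proj₁ (proj₂ (proj₂ products)) ,
        ℕ.≤-trans (power-bound t (suc (t ℕ.+ t) !) (length A) r elementBound (length (tuples (suc (t ℕ.+ t)) Y)) (length L)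
            bound ≡.refl
            (≡.subst (λ n → n ^ suc (t ℕ.+ t) ≤ suc (t ℕ.+ t) ! * length (tuples (suc (t ℕ.+ t)) Y)) length-Y
              (length-tuples (suc (t ℕ.+ t)) Y))
            (≡.subst (λ n → length (tuples (suc (t ℕ.+ t)) Y) * n ≤ length L * length L) length-Y
              (proj₂ (proj₂ (proj₂ products)))))
          (ℕ.*-monoˡ-≤ (length L) (ℕ.n≤1+n constant))
        where
        L : List Carrier
        L = proj₁ products
        length-Y : length Y ≡ suc r
        length-Y = ≡.trans (length-map normalise Z) e
        bound : length A ≤ elementBound * suc r
        bound = ℕ.≤-trans length-A (≡.subst (λ n → suc spacing ℕ.+ suc spacing * n ≤ elementBound * suc r) (≡.sym e)
          (ℕ.≤-trans (ℕ.+-monoˡ-≤ (suc spacing * suc r) (ℕ.m≤m*n (suc spacing) (suc r)))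
            (ℕ.≤-reflexive (≡.sym (ℕ.*-distribʳ-+ (suc r) (suc spacing) (suc spacing))))))

    from-increasing : ReciprocalSqueezed (t ℕ.+ t) C → ∀ S → S ↭ A → AllPairs _<_ S → Conclusion
    -- An empty A has no products at all, and the bound holds because the exponent t + 1 is
    -- positive.
    from-increasing _ [] perm _ = [] , [] , [] , ≡.subst (λ n → n ^ suc t ≤ suc constant * 0) (↭-length perm) ℕ.z≤n
    from-increasing _ (x ∷ []) perm _ = few-elements (Any.map reflexive (∈-resp-↭ perm (here ≡.refl)))
      (≡.subst (_≤ elementBound) (↭-length perm) (ℕ.s≤s ℕ.z≤n))
    from-increasing decreasing (x₀ ∷ x₁ ∷ l) perm incr = close (minimal-gap x₀ x₁ l incr)
      where
      inA : ∀ {z} → z ∈ x₀ ∷ x₁ ∷ l → InA z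
      inA m = Any.map reflexive (∈-resp-↭ perm m)

      close : (Σ Carrier λ b → Σ Carrier λ b′ → b ∈ x₀ ∷ x₁ ∷ l × b′ ∈ x₀ ∷ x₁ ∷ l × b < b′ ×
        AllPairs (λ p q → p + (b′ - b) ≼ q) (x₀ ∷ x₁ ∷ l)) → Conclusion
      -- The least element serves as base point and is left out of Z. Starting with a full skip puts
      -- the first kept point (spacing + 1)δ beyond it, enough to remain at least 2a after t is
      -- subtracted.
      close (b , b′ , b∈ , b′∈ , b<b′ , far ∷ gaps) = Sparse.conclude decreasing
        (inA (here ≡.refl)) (inA b∈) (inA b′∈) (<⇒Pos-diff b<b′)
        (sparse-All spacing spacing (All.tabulate (λ m → inA (there m))))
        (sparse-far spacing spacing far gaps) (sparse-gaps spacing spacing gaps)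
        (≡.subst (_≤ suc spacing ℕ.+ suc spacing * length (sparse spacing spacing (x₁ ∷ l))) (↭-length perm)
          (ℕ.s≤s (sparse-length spacing spacing (x₁ ∷ l))))
        _ ≡.refl

    from-distinct : ReciprocalSqueezed (t ℕ.+ t) C → Distinct R A → Conclusion
    from-distinct decreasing distinct with increasing-permutation A distinct
    ... | S , perm , incr = from-increasing decreasing S perm incr

theorem1p4 : (s : ℕ) → Σ ℕ λ m → Σ ℕ λ k →
    (R : RealNumbers) → (A : List (RealNumbers.Carrier R)) → Distinct R A →
    Σ (List (RealNumbers.Carrier R)) λ L →
    Distinct R L × All (InProdSet R m (InSumDiff R s A)) L ×
    (length A ^ s ≤ suc k * length L)
-- For s = 0 the empty product 1 alone matches length A ^ 0 = 1, whether or not A is empty.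
theorem1p4 ℕ.zero  = 0 , 0 , λ R A _ →
  RealNumbers.1# R ∷ [] , [] ∷ [] , ((λ ()) , (λ ()) , RealNumbers.refl R) ∷ [] , ℕ.≤-refl
theorem1p4 (suc t) = factorCount (t ℕ.+ t) , constant t C , λ R A distinct →
  from-distinct t C R A decreasing distinct
  where
  C : ℕ
  C = proj₁ (reciprocal-squeezed (t ℕ.+ t))
  decreasing : ReciprocalSqueezed (t ℕ.+ t) C
  decreasing = proj₂ (reciprocal-squeezed (t ℕ.+ t))
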